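{- For every fixed $m$, the formulas $\mathrm{GS}_{m,n}$ ($m\ge 3$, $n\ge 2$) have a kernelization of length $O(n)$ (i.e. with data reduction chains of length $O(n)$) whose soundness has polynomial size Frege proofs. Hence, the formulas $\mathrm{GS}_{m,n}$ expressing the Gibbard–Satterthwaite theorem have (a) Frege proofs (of unsatisfiability) of size quasipolynomial in $|\mathrm{GS}_{m,n}|$; (b) for every fixed $n$, Frege proofs (of unsatisfiability) of size polynomial in $|\mathrm{GS}_{m,n}|$.
   Context: There are $n$ agents and $m$ objects, identified with $[m]=\{1,\dots,m\}$. A ranking is a permutation $\pi\in S_m$; $a$ is preferred to $b$ in $\pi$ iff $\pi^{ -1}(a)<\pi^{ -1}(b)$; $top(\pi)$ is the object preferred to all others in $\pi$. Let $\mathcal R=S_m^n$ be the set of profiles $R=(R_1,\ldots,R_n)$. For a profile $R$, object $o$ and agent $i$, $pr(i,o,R)$ is the set of objects $o'$ with $R_i^{ -1}(o)\le R_i^{ -1}(o')$ ($i$ weakly prefers $o$ to $o'$). For $\pi\in S_m$, $s(i,R,\pi)$ is the profile obtained from $R$ by replacing $R_i$ with $\pi$. The CNF $\mathrm{GS}_{m,n}$ has a variable $X_{R,o}$ for each $R\in\mathcal R$, $o\in[m]$, and the clauses: (i) for each $R$: $\bigvee_{o\in[m]}X_{R,o}$, and for $o_1\neq o_2$: $\overline{X_{R,o_1}}\vee\overline{X_{R,o_2}}$; (ii) (non-dictatorship) for each agent $i=1,\ldots,n$: $\bigvee_{R\in\mathcal R}\overline{X_{R,top(R_i)}}$; (iii)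 (onto) for each $o\in[m]$: $\bigvee_{R\in\mathcal R}X_{R,o}$; (iv) (strategyproofness) for every $R\in\mathcal R$, $o\in[m]$, agent $1\le i\le n$ and $\pi\in S_m$: $\overline{X_{R,o}}\vee\bigvee_{o'\in pr(i,o,R)}X_{s(i,R,\pi),o'}$. Proof systems. A Frege system is a sound and complete propositional proof system with finitely many axiom schemes and rules (all are polynomially equivalent; fix one whose only rule is modus ponens). The length (size) of a proof is measured by the number of clauses in it. A proof for an unsatisfiable formula means a refutation. A function $f$ is quasipolynomial if $f(N)=O(2^{O(\log^{c} N)})$ for some $c>0$. Witnessing $\Phi_1\vdash\Phi_2$ by Frege proofs means: with disjoint variables $X,Y$ for $\Phi_1,\Phi_2$, there are substitutions $Y_i=\Xi_i[X]$ such that the clauses of $\Phi_2[Y]$, with the substitutions expanded, have a derivation from the clauses of $\Phi_1[X]$. Kernelization. Instances are here the pairs $(m,n)$, with formula $\Phi=\mathrm{GS}_{m,n}$; no separate parameter is designated, so the kernel consists of instances of bounded size. The kernelization is obtained by applying finitely many data reduction rules (mapping an instance to an equivalent, not larger one) as long as possible; a data reduction chain is the sequence of instances $x_0=(m,n),x_1,x_2,\ldots$ so obtained, its length being the number of steps. Its soundness has polynomial size Frege proofs if there are an integer $R\ge 1$ and a polynomial $h$ such that for each step $x_i\to x_{i+1}$ of the chain of an instance $x$ there are a tautology $\bigvee_{t=1}^{r}\Xi_{i,t}$ with $r\le R$ and formulas $\eta_{i,t}$ isomorphic (up to renaming) to $\Phi(x_{i+1})$ such that this tautology and all implications $\Phi(x_i)\wedge\Xi_{i,t}\vdash\eta_{i,t}$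 have Frege proofs of total size at most $h(|\Phi(x)|)$. -}

module Defs where

open import Data.Bool.Base using (Bool; true; false; if_then_else_)
open import Data.Fin.Base using (Fin)
open import Data.Fin.Properties using (_≟_)
open import Data.List.Base
  using (List; []; _∷_; _++_; map; foldr; length; filter; mapMaybe;
         concatMap; cartesianProduct; cartesianProductWith; allFin; tabulate)
open import Data.List.Membership.Propositional using (_∈_)
open import Data.List.Relation.Unary.All using (All)
open import Data.List.Relation.Unary.Any using (Any)
open import Data.Maybe.Base using (Maybe; just; nothing)
open import Data.Nat.Base
  using (ℕ; zero; suc; _+_; _*_; _^_; _≤_; _<_; NonZero; >-nonZero; z≤n; s≤s)
open import Data.Nat.ListAction using (sum)
open import Data.Nat.Logarithm using (⌈log₂_⌉)
open import Data.Nat.Properties using (_≤?_; ≤-trans)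
open import Data.Product.Base using (Σ; ∃; _×_; _,_)
open import Data.Vec.Base using (Vec; head; lookup; _[_]≔_) renaming ([] to []ᵥ; _∷_ to _∷ᵥ_)
open import Data.Vec.Relation.Unary.AllPairs using (allPairs?)
open import Data.Vec.Relation.Unary.Unique.Propositional using (Unique)
open import Function.Bundles using (_↔_; _⇔_; Inverse)
open import Relation.Binary.Construct.Closure.ReflexiveTransitive using (Star; ε; _◅_)
open import Relation.Binary.PropositionalEquality.Core using (_≡_)
open import Relation.Nullary.Decidable.Core using (does; yes; no; ¬?)

infixr 7 _∧_
infixr 6 _∨_
infixr 5 _⇒_

data Form (V : Set) : Set where
  var         : V → Form V
  ⊥           : Form V
  _∧_ _∨_ _⇒_ : Form V → Form V → Form V

¬_ : {V : Set} → Form V → Form V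
¬ A = A ⇒ ⊥

⋁ : {V : Set} → List (Form V) → Form V
⋁ = foldr _∨_ ⊥

infixl 8 _[_]

_[_] : {V W : Set} → Form V → (V → Form W) → Form W
var v   [ σ ] = σ v
⊥       [ σ ] = ⊥
(A ∧ B) [ σ ] = A [ σ ] ∧ B [ σ ]
(A ∨ B) [ σ ] = A [ σ ] ∨ B [ σ ]
(A ⇒ B) [ σ ] = A [ σ ] ⇒ B [ σ ]

data Literal (V : Set) : Set where
  pos neg : V → Literal V

Clause : Set → Set
Clause V = List (Literal V)

CNF : Set → Set
CNF V = List (Clause V)

∣_∣ : {V : Set} → CNF V → ℕ
∣ Φ ∣ = sum (map length Φ)

renameLiteral : {V W : Set} → (V → W) → Literal V → Literal W
renameLiteral ρ (pos v) = pos (ρ v)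
renameLiteral ρ (neg v) = neg (ρ v)

rename : {V W : Set} → (V → W) → CNF V → CNF W
rename ρ = map (map (renameLiteral ρ))

data True {V : Set} (α : V → Bool) : Literal V → Set where
  pos : ∀ {v} → α v ≡ true  → True α (pos v)
  neg : ∀ {v} → α v ≡ false → True α (neg v)

Satisfiable : {V : Set} → CNF V → Set
Satisfiable {V} Φ = ∃ λ (α : V → Bool) → All (Any (True α)) Φ

literalForm : {V : Set} → Literal V → Form V
literalForm (pos v) = var v
literalForm (neg v) = ¬ var v

clauseForm : {V : Set} → Clause V → Form V
clauseForm C = ⋁ (map literalForm C)

clauseForms : {V : Set} → CNF V → List (Form V)
clauseForms = map clauseForm

-- Axiom schemes of a Hilbert system complete for classical logic over
-- ⊥, ∧, ∨, ⇒; the only rule is modus ponens.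
data Axiom {V : Set} : Form V → Set where
  K    : ∀ A B   → Axiom (A ⇒ B ⇒ A)
  S    : ∀ A B C → Axiom ((A ⇒ B ⇒ C) ⇒ (A ⇒ B) ⇒ A ⇒ C)
  pair : ∀ A B   → Axiom (A ⇒ B ⇒ A ∧ B)
  fst  : ∀ A B   → Axiom (A ∧ B ⇒ A)
  snd  : ∀ A B   → Axiom (A ∧ B ⇒ B)
  inl  : ∀ A B   → Axiom (A ⇒ A ∨ B)
  inr  : ∀ A B   → Axiom (B ⇒ A ∨ B)
  case : ∀ A B C → Axiom ((A ⇒ C) ⇒ (B ⇒ C) ⇒ A ∨ B ⇒ C)
  dne  : ∀ A     → Axiom (¬ ¬ A ⇒ A)

-- Derivation Γ L: the sequence L, listed with its last line first, is a
-- derivation from the hypotheses Γ.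
data Derivation {V : Set} (Γ : List (Form V)) : List (Form V) → Set where
  []    : Derivation Γ []
  hyp   : ∀ {A L} → A ∈ Γ → Derivation Γ L → Derivation Γ (A ∷ L)
  axiom : ∀ {A L} → Axiom A → Derivation Γ L → Derivation Γ (A ∷ L)
  mp    : ∀ {A B L} → A ∈ L → (A ⇒ B) ∈ L → Derivation Γ L → Derivation Γ (B ∷ L)

-- A single derivation from Γ in which all formulas of Δ occur.
record FregeProof {V : Set} (Γ Δ : List (Form V)) : Set where
  field
    lines      : List (Form V)
    derivation : Derivation Γ lines
    derives    : All (_∈ lines) Δ

  -- The number of lines, not of symbols.
  size : ℕ
  size = length lines

Refutation : {V : Set} → CNF V → Set
Refutation Φ = FregeProof (clauseForms Φ) (⊥ ∷ [])

HasRefutationOfSize≤ : {V : Set} → CNF V → ℕ → Set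
HasRefutationOfSize≤ Φ s = ∃ λ (π : Refutation Φ) → FregeProof.size π ≤ s

-- Frege proofs of Γ ⊢ Ψ; the variables of Ψ are disjoint from those of Γ
-- and are substituted by formulas in the latter.
record Witnessing {V W : Set} (Γ : List (Form V)) (Ψ : CNF W) : Set where
  field
    substitution : W → Form V
    proof        : FregeProof Γ (map (_[ substitution ]) (clauseForms Ψ))

  size : ℕ
  size = FregeProof.size proof

-- A formula isomorphic, up to renaming of variables, to Ψ.
record Copy {W : Set} (Ψ : CNF W) : Set₁ where
  field
    Name      : Set
    formula   : CNF Name
    bijection : W ↔ Name
    renamed   : formula ≡ rename (Inverse.to bijection) Ψ

-- Coefficients in increasing degree.
Polynomial : Set
Polynomial = List ℕ

eval : Polynomial → ℕ → ℕ
eval p x = foldr (λ a r → a + x * r) 0 p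

-- f(N) = O(2^O(log^c N)) for some c > 0; since log N ≥ 1 for N ≥ 2,
-- nothing is lost by taking c to be an integer.
Quasipolynomial : (ℕ → ℕ) → Set
Quasipolynomial f =
  ∃ λ c → 0 < c × (∃ λ a → ∃ λ b → ∃ λ N₀ →
    ∀ N → N₀ ≤ N → f N ≤ a * 2 ^ (b * ⌈log₂ N ⌉ ^ c))

-- The permutation π is stored as (π(1), …, π(m)), the best object first.
-- The proof is irrelevant so that rankings, and hence the variables
-- indexed by them, are equal as soon as their vectors are.
record Ranking (m : ℕ) : Set where
  constructor ranking
  field
    objects : Vec (Fin m) m
    .unique : Unique objects

Profile : ℕ → ℕ → Set
Profile m n = Vec (Ranking m) n

firstIndex : ∀ {m k} → Fin m → Vec (Fin m) k → ℕ
firstIndex o []ᵥ       = 0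
firstIndex o (x ∷ᵥ xs) = if does (x ≟ o) then 0 else suc (firstIndex o xs)

-- π⁻¹(o), counted from 0.
_⁻¹⟨_⟩ : ∀ {m} → Ranking m → Fin m → ℕ
π ⁻¹⟨ o ⟩ = firstIndex o (Ranking.objects π)

top : ∀ {m} .{{_ : NonZero m}} → Ranking m → Fin m
top {suc _} π = head (Ranking.objects π)

pr : ∀ {m n} → Fin n → Fin m → Profile m n → List (Fin m)
pr {m} i o R = filter (λ o′ → lookup R i ⁻¹⟨ o ⟩ ≤? lookup R i ⁻¹⟨ o′ ⟩) (allFin m)

s : ∀ {m n} → Fin n → Profile m n → Ranking m → Profile m n
s i R π = R [ i ]≔ π

allVecs : {A : Set} → List A → (n : ℕ) → List (Vec A n)
allVecs xs zero    = []ᵥ ∷ []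
allVecs xs (suc n) = cartesianProductWith _∷ᵥ_ xs (allVecs xs n)

toRanking : ∀ {m} → Vec (Fin m) m → Maybe (Ranking m)
toRanking v with allPairs? (λ x y → ¬? (x ≟ y)) v
... | yes u = just (ranking v u)
... | no  _ = nothing

rankings : ∀ m → List (Ranking m)
rankings m = mapMaybe toRanking (allVecs (allFin m) m)

profiles : ∀ m n → List (Profile m n)
profiles m n = allVecs (rankings m) n

Var : ℕ → ℕ → Set
Var m n = Profile m n × Fin m

module _ (m n : ℕ) where

  someObject : CNF (Var m n)
  someObject = map (λ R → map (λ o → pos (R , o)) (allFin m)) (profiles m n)

  distinctPairs : List (Fin m × Fin m)
  distinctPairs = filter (λ (o₁ , o₂) → ¬? (o₁ ≟ o₂)) (cartesianProduct (allFin m) (allFin m))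

  atMostOneObject : CNF (Var m n)
  atMostOneObject =
    cartesianProductWith (λ R (o₁ , o₂) → neg (R , o₁) ∷ neg (R , o₂) ∷ [])
      (profiles m n) distinctPairs

  nonDictatorship : .{{_ : NonZero m}} → CNF (Var m n)
  nonDictatorship =
    map (λ i → map (λ R → neg (R , top (lookup R i))) (profiles m n)) (allFin n)

  onto : CNF (Var m n)
  onto = map (λ o → map (λ R → pos (R , o)) (profiles m n)) (allFin m)

  strategyproofness : CNF (Var m n)
  strategyproofness =
    concatMap (λ R → concatMap (λ o → concatMap (λ i → map (λ π →
        neg (R , o) ∷ map (λ o′ → pos (s i R π , o′)) (pr i o R))
      (rankings m)) (allFin n)) (allFin m)) (profiles m n)

  GS : .{{_ : NonZero m}} → CNF (Var m n)
  GS = someObject ++ atMostOneObject ++ nonDictatorship ++ onto ++ strategyproofness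

record Instance : Set where
  constructor inst
  field
    objects    : ℕ
    agents     : ℕ
    .objects≥3 : 3 ≤ objects
    .agents≥2  : 2 ≤ agents

open Instance public using (objects; agents)

VarOf : Instance → Set
VarOf x = Var (objects x) (agents x)

Φ : (x : Instance) → CNF (VarOf x)
Φ (inst m n m≥3 _) = GS m n {{>-nonZero (≤-trans (s≤s z≤n) m≥3)}}

-- A rule is inapplicable to x when reduce x is nothing.
record Rule : Set where
  field
    reduce     : Instance → Maybe Instance
    equivalent : ∀ {x y} → reduce x ≡ just y → Satisfiable (Φ x) ⇔ Satisfiable (Φ y)
    notLarger  : ∀ {x y} → reduce x ≡ just y → ∣ Φ y ∣ ≤ ∣ Φ x ∣

module _ (rules : List Rule) where

  Step : Instance → Instance → Set
  Step x y = Any (λ ρ → Rule.reduce ρ x ≡ just y) rules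

  -- Not necessarily maximal: y may still be reducible.
  Chain : Instance → Instance → Set
  Chain = Star Step

  chainLength : ∀ {x y} → Chain x y → ℕ
  chainLength ε       = 0
  chainLength (_ ◅ c) = suc (chainLength c)

  Irreducible : Instance → Set
  Irreducible x = All (λ ρ → Rule.reduce ρ x ≡ nothing) rules

-- A kernelization of the instances in P: exhaustive application of the
-- rules, in whatever order, ends in an instance of bounded size.
record Kernelization (P : Instance → Set) : Set where
  field
    rules  : List Rule
    bound  : ℕ
    kernel : ∀ {x y} → P x → Chain rules x y → Irreducible rules y → ∣ Φ y ∣ ≤ bound

module _ {P : Instance → Set} (K : Kernelization P) where

  open Kernelization K using (rules)

  LinearLength : Set
  LinearLength =
    ∃ λ c → ∀ {x y} → P x → (ch : Chain rules x y) → chainLength rules ch ≤ c * agents x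

record StepSoundness (x y : Instance) (R N : ℕ) : Set₁ where
  field
    r            : ℕ
    r≤R          : r ≤ R
    Ξ            : Fin r → Form (VarOf x)
    tautology    : FregeProof [] (⋁ (tabulate Ξ) ∷ [])
    η            : Fin r → Copy (Φ y)
    implications : ∀ t → Witnessing (Ξ t ∷ clauseForms (Φ x)) (Copy.formula (η t))
    totalSize    : FregeProof.size tautology
                     + sum (tabulate λ t → Witnessing.size (implications t)) ≤ N

module _ {P : Instance → Set} (K : Kernelization P) where

  open Kernelization K using (rules)

  PolynomialSoundness : Set₁
  PolynomialSoundness =
    Σ ℕ λ R → 1 ≤ R × Σ Polynomial λ h →
      ∀ {x y z} → P x → Chain rules x y → Step rules y z →
        StepSoundness y z R (eval h ∣ Φ x ∣)

{-# OPTIONS --safe #-}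

-- Call a group T of agents decisive for y if y is chosen whenever all of T rank
-- it first. By strategyproofness the outcome a persists when no agent's lower
-- contour set of a shrinks; hence every object that is attained is chosen by
-- unanimity, and a group that wins one duel is decisive for all objects. Take an
-- agent j such that {i ≤ j} wins the duel of two objects while {i < j} loses it.
-- If {j} wins its duel, j is a dictator. Otherwise {i ≤ j}, {i ≥ j} and {i ≠ j}
-- are all decisive, and on a Condorcet cycle every outcome can be improved upon by
-- one of them. Each step concerns polynomially many profiles, so this is a Frege
-- refutation with polynomially many lines for all m ≥ 3 and n. The kernelization
-- removes one agent at a time until two are left; the refutation makes each step
-- sound.
module Submission where

open import Defs
open import Data.Bool.Base using (Bool; true; false; if_then_else_; not)
open import Data.Bool.Properties using (not-injective; T-≡; if-not)
import Data.Empty as Empty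
open import Data.Fin.Base using (Fin; zero; suc; toℕ; fromℕ<; punchOut)
open import Data.Fin.Properties
  using (_≟_; toℕ<n; toℕ-fromℕ<; toℕ-injective; injective⇒≤; punchOut-injective)
open import Data.List.Base as List
  using (List; []; _∷_; _++_; length; map; replicate; concat; concatMap;
         cartesianProductWith; mapMaybe; allFin)
open import Data.List.Membership.Propositional using (_∈_)
open import Data.List.Membership.Propositional.Properties
  using (∈-++⁺ˡ; ∈-++⁺ʳ; ∈-map⁺; ∈-map⁻; ∈-filter⁺; ∈-filter⁻; ∈-allFin; ∈-concatMap⁺;
         ∈-cartesianProduct⁺; ∈-cartesianProductWith⁺)
open import Data.List.Properties using (length-map; length-++; length-tabulate; map-++; map-∘)
open import Data.List.Relation.Unary.All as All using (All; []; _∷_)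
import Data.List.Relation.Unary.All.Properties as All
open import Data.List.Relation.Unary.Any as Any using (Any; here; there)
open import Data.Maybe.Base using (Maybe; just; nothing)
open import Data.Nat.Base
  using (ℕ; zero; suc; pred; _+_; _*_; _^_; _≤_; _<_; _<ᵇ_; z≤n; s≤s; NonZero; ⌊_/2⌋; ⌈_/2⌉)
open import Data.Nat.Induction using (Acc; acc; <-wellFounded)
open import Data.Nat.ListAction using (sum)
open import Data.Nat.ListAction.Properties using (sum-++)
open import Data.Nat.Logarithm using (⌈log₂_⌉)
open import Data.Nat.Logarithm.Core using (⌈log2⌉)
open import Data.Nat.Properties hiding (_≟_)
open import Data.Nat.Tactic.RingSolver using (solve-∀)
open import Data.Product.Base using (Σ; ∃; _×_; _,_; proj₁; proj₂)
open import Data.Vec.Base as Vec using (Vec; []; _∷_; lookup; tabulate; _[_]≔_)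
open import Data.Vec.Membership.Propositional using () renaming (_∈_ to _∈ᵥ_; _∉_ to _∉ᵥ_)
open import Data.Vec.Membership.Propositional.Properties using () renaming (∈-lookup to ∈ᵥ-lookup)
open import Data.Vec.Properties
  using (lookup∘update; lookup∘update′; tabulate-cong; tabulate∘lookup; lookup∘tabulate;
         []≔-idempotent; []≔-lookup)
open import Data.Vec.Relation.Unary.All using ([]; _∷_) renaming (All to Allᵥ)
open import Data.Vec.Relation.Unary.AllPairs using ([]; _∷_; allPairs?)
open import Data.Vec.Relation.Unary.Any using (here; there) renaming (any? to anyᵥ?)
open import Data.Vec.Relation.Unary.Unique.Propositional using (Unique)
open import Data.Vec.Relation.Unary.Unique.Propositional.Properties using (lookup-injective; tabulate⁺)
open import Function.Base using (id; _∘_; const)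
open import Function.Bundles using (_⇔_; mk⇔; Equivalence)
open import Function.Construct.Identity using (↔-id)
import Function.Properties.Equivalence as ⇔
open import Relation.Binary.Construct.Closure.ReflexiveTransitive using (ε; _◅_)
open import Relation.Binary.PropositionalEquality
  using (_≡_; _≢_; refl; sym; trans; cong; cong₂; subst; subst₂; ≢-sym)
open import Relation.Nullary.Decidable using (Dec; yes; no; does; ¬?; recompute)
open import Relation.Nullary.Negation using (Stable; contradiction; contradiction-irr)

-- Rankings

module _ {m : ℕ} where

  -- Pigeonhole: if `o` were missing, punching it out would inject the `m` positions into a set of
  -- `m - 1` objects.
  unique⇒∈ : (v : Vec (Fin m) m) → Unique v → ∀ o → o ∈ᵥ v
  unique⇒∈ v u o with anyᵥ? (o ≟_) v
  ... | yes o∈v = o∈v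
  ... | no  o∉v = contradiction (missing⇒< v u o o∉v) (<-irrefl refl)
    where
    missing⇒< : ∀ {m} (v : Vec (Fin m) m) → Unique v → ∀ o → o ∉ᵥ v → m < m
    missing⇒< {suc m} v u o o∉v =
      Empty.⊥-elim (<-irrefl refl (injective⇒≤ {f = λ i → punchOut (o≢ i)}
        (λ {i} {j} eq → lookup-injective u i j (punchOut-injective (o≢ i) (o≢ j) eq))))
      where
      o≢ : ∀ i → o ≢ lookup v i
      o≢ i eq = o∉v (subst (_∈ᵥ v) (sym eq) (∈ᵥ-lookup i v))

  -- Membership of `a` suffices: the index of an absent object is the length of the vector, which
  -- the index of a present one never reaches.
  firstIndex-injective : ∀ {k} {a b} {v : Vec (Fin m) k} → a ∈ᵥ v →
    firstIndex a v ≡ firstIndex b v → a ≡ b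
  firstIndex-injective {a = a} {b} {x ∷ v} a∈v eq with x ≟ a | x ≟ b
  ... | yes refl | yes refl = refl
  firstIndex-injective a∈v () | yes _ | no _
  firstIndex-injective a∈v () | no _  | yes _
  firstIndex-injective (here refl) eq | no x≢a | no _ = contradiction refl x≢a
  firstIndex-injective (there a∈v) eq | no _ | no _ =
    firstIndex-injective a∈v (cong pred eq)

  -- If y is not among the entries, the last entry is dropped instead.
  remove : ∀ {k} → Fin m → Vec (Fin m) (suc k) → Vec (Fin m) k
  remove {zero}  y (x ∷ [])  = []
  remove {suc k} y (x ∷ xs) with x ≟ y
  ... | yes _ = xs
  ... | no  _ = x ∷ remove y xs

  remove-All : ∀ {P : Fin m → Set} {k} y {v : Vec (Fin m) (suc k)} → Allᵥ P v → Allᵥ P (remove y v)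
  remove-All {k = zero}  y {x ∷ []} _ = []
  remove-All {k = suc k} y {x ∷ v} (p ∷ ps) with x ≟ y
  ... | yes _ = ps
  ... | no  _ = p ∷ remove-All y ps

  remove-≢ : ∀ {k} y {v : Vec (Fin m) (suc k)} → Unique v → Allᵥ (y ≢_) (remove y v)
  remove-≢ {zero}  y {x ∷ []} _ = []
  remove-≢ {suc k} y {x ∷ v} (x∉v ∷ u) with x ≟ y
  ... | yes refl = x∉v
  ... | no  x≢y  = (x≢y ∘ sym) ∷ remove-≢ y u

  remove-unique : ∀ {k} y {v : Vec (Fin m) (suc k)} → Unique v → Unique (remove y v)
  remove-unique {zero}  y {x ∷ []} _ = []
  remove-unique {suc k} y {x ∷ v} (x∉v ∷ u) with x ≟ y
  ... | yes _ = u
  ... | no  _ = remove-All y x∉v ∷ remove-unique y u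

  firstIndex-∷ : ∀ {k} {x a} {v : Vec (Fin m) k} → a ≢ x →
    firstIndex a (x ∷ v) ≡ suc (firstIndex a v)
  firstIndex-∷ {x = x} {a} a≢x with x ≟ a
  ... | yes refl = contradiction refl a≢x
  ... | no  _    = refl

  ∷-≤ : ∀ {k} {x a b} (v : Vec (Fin m) k) → a ≢ x → b ≢ x →
    firstIndex a (x ∷ v) ≤ firstIndex b (x ∷ v) ⇔ firstIndex a v ≤ firstIndex b v
  ∷-≤ v a≢x b≢x rewrite firstIndex-∷ {v = v} a≢x | firstIndex-∷ {v = v} b≢x =
    mk⇔ (λ { (s≤s le) → le }) s≤s

  -- Deleting `y` shifts the later entries by one place and so keeps their order. If `y` were
  -- absent, the last entry would be dropped and would then tie with absent objects.
  remove-≤ : ∀ {k} {y a b} {v : Vec (Fin m) (suc k)} → y ∈ᵥ v → a ≢ y → b ≢ y →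
    firstIndex a (remove y v) ≤ firstIndex b (remove y v) ⇔ firstIndex a v ≤ firstIndex b v
  remove-≤ {zero} {v = x ∷ []} (here refl) a≢y b≢y =
    mk⇔ (Equivalence.from (∷-≤ [] a≢y b≢y)) (λ _ → z≤n)
  remove-≤ {suc k} {y} {v = x ∷ v} y∈v a≢y b≢y with x ≟ y
  ... | yes refl = ⇔.sym (∷-≤ v a≢y b≢y)
  remove-≤ {suc k} {v = x ∷ v} (here y≡x) a≢y b≢y | no x≢y = contradiction (sym y≡x) x≢y
  remove-≤ {suc k} {a = a} {b} {v = x ∷ v} (there y∈v) a≢y b≢y | no x≢y with x ≟ a | x ≟ b
  ... | yes refl | yes refl = mk⇔ id id
  ... | yes refl | no _     = mk⇔ (λ _ → z≤n) (λ _ → z≤n)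
  ... | no _     | yes refl = mk⇔ (λ ()) (λ ())
  ... | no _     | no _     = mk⇔ (λ { (s≤s le) → s≤s (to le) }) (λ { (s≤s le) → s≤s (from le) })
    where open Equivalence (remove-≤ {v = v} y∈v a≢y b≢y)

infix 4 _≽[_]_

_≽[_]_ : ∀ {m} → Fin m → Ranking m → Fin m → Set
a ≽[ π ] b = π ⁻¹⟨ a ⟩ ≤ π ⁻¹⟨ b ⟩

Top : ∀ {m} → Fin m → Ranking m → Set
Top a π = ∀ o → a ≽[ π ] o

-- The condition of Maskin monotonicity: the lower contour set of `a` does not shrink.
Monotonic : ∀ {m} → Fin m → Ranking m → Ranking m → Set
Monotonic a π π′ = ∀ o → a ≽[ π ] o → a ≽[ π′ ] o

-- The stored uniqueness proof is irrelevant; decidability recovers a usable one.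
occurs : ∀ {m} (π : Ranking m) o → o ∈ᵥ Ranking.objects π
occurs (ranking v u) o = unique⇒∈ v (recompute (allPairs? (λ x y → ¬? (x ≟ y)) v) u) o

≽-antisym : ∀ {m} (π : Ranking m) {a b} → a ≽[ π ] b → b ≽[ π ] a → a ≡ b
≽-antisym π a≽b b≽a = firstIndex-injective (occurs π _) (≤-antisym a≽b b≽a)

top-Top : ∀ {m} .{{_ : NonZero m}} (π : Ranking m) → Top (top π) π
top-Top {suc m} (ranking (x ∷ v) u) o with x ≟ x
... | yes _   = z≤n
... | no  x≢x = contradiction refl x≢x

raise : ∀ {m} → Fin m → Ranking m → Ranking m
raise {suc m} y (ranking v u) = ranking (y ∷ remove y v) (remove-≢ y u ∷ remove-unique y u)

raise-Top : ∀ {m} (y : Fin m) π → Top y (raise y π)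
raise-Top {suc m} y π = top-Top (raise y π)

raise-≽ : ∀ {m} {y a b : Fin m} (π : Ranking m) → a ≢ y → b ≢ y →
  a ≽[ raise y π ] b ⇔ a ≽[ π ] b
raise-≽ {suc m} {y} π a≢y b≢y =
  ⇔.trans (∷-≤ (remove y (Ranking.objects π)) a≢y b≢y) (remove-≤ (occurs π y) a≢y b≢y)

-- An arbitrary ranking, on top of which the relevant objects are raised; it also witnesses that
-- rankings exist.
identity : ∀ {m} → Ranking m
identity = ranking (tabulate id) (tabulate⁺ id)

-- Frege proofs with counted lines

-- Trees compose without any bookkeeping of line positions. Writing one out as a sequence repeats
-- shared subproofs, and `treeSize` counts these repetitions.
data Tree {V : Set} (Γ : List (Form V)) : Form V → Set where
  hyp   : ∀ {A} → A ∈ Γ → Tree Γ A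
  axiom : ∀ {A} → Axiom A → Tree Γ A
  mp    : ∀ {A B} → Tree Γ (A ⇒ B) → Tree Γ A → Tree Γ B

module _ {V : Set} {Γ : List (Form V)} where

  treeSize : ∀ {A} → Tree Γ A → ℕ
  treeSize (hyp _)   = 1
  treeSize (axiom _) = 1
  treeSize (mp t u)  = suc (treeSize t + treeSize u)

  _++ᵈ_ : ∀ {L M} → Derivation Γ L → Derivation Γ M → Derivation Γ (L ++ M)
  []         ++ᵈ e = e
  hyp i d    ++ᵈ e = hyp i (d ++ᵈ e)
  axiom a d  ++ᵈ e = axiom a (d ++ᵈ e)
  mp i j d   ++ᵈ e = mp (∈-++⁺ˡ i) (∈-++⁺ˡ j) (d ++ᵈ e)

  flatten : ∀ {A} → Tree Γ A → List (Form V)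
  flatten {A} (hyp _)   = A ∷ []
  flatten {A} (axiom _) = A ∷ []
  flatten {A} (mp t u)  = A ∷ flatten t ++ flatten u

  flatten-root : ∀ {A} (t : Tree Γ A) → A ∈ flatten t
  flatten-root (hyp _)   = here refl
  flatten-root (axiom _) = here refl
  flatten-root (mp _ _)  = here refl

  flatten-derivation : ∀ {A} (t : Tree Γ A) → Derivation Γ (flatten t)
  flatten-derivation (hyp i)   = hyp i []
  flatten-derivation (axiom a) = axiom a []
  flatten-derivation (mp t u)  =
    mp (∈-++⁺ʳ (flatten t) (flatten-root u)) (∈-++⁺ˡ (flatten-root t))
      (flatten-derivation t ++ᵈ flatten-derivation u)

  length-flatten : ∀ {A} (t : Tree Γ A) → length (flatten t) ≡ treeSize t
  length-flatten (hyp _)   = refl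
  length-flatten (axiom _) = refl
  length-flatten (mp t u)  = cong suc
    (trans (length-++ (flatten t)) (cong₂ _+_ (length-flatten t) (length-flatten u)))

  fregeProof : ∀ {A} → Tree Γ A → FregeProof Γ (A ∷ [])
  fregeProof t = record
    { lines      = flatten t
    ; derivation = flatten-derivation t
    ; derives    = flatten-root t ∷ []
    }

-- Polynomial bounds on line counts

infixl 6 _⊕_
infixl 7 _⊗_

-- Line counts as formal polynomials in the size N of the refuted CNF, so that
-- bounds are visibly uniform in m and n. The bound in H ⊢ A # _ is found by
-- unification.
data Cost : Set where
  con     : ℕ → Cost
  N       : Cost
  _⊕_ _⊗_ : Cost → Cost → Cost

⟦_⟧ : Cost → ℕ → ℕ
⟦ con c ⟧ x = c
⟦ N ⟧     x = x
⟦ p ⊕ q ⟧ x = ⟦ p ⟧ x + ⟦ q ⟧ x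
⟦ p ⊗ q ⟧ x = ⟦ p ⟧ x * ⟦ q ⟧ x

-- A single dominating monomial. Exponents are added even for sums: cruder than a maximum, but
-- harmless for arguments at least 1.
coefficient exponent : Cost → ℕ
coefficient (con c) = c
coefficient N       = 1
coefficient (p ⊕ q) = coefficient p + coefficient q
coefficient (p ⊗ q) = coefficient p * coefficient q
exponent (con c) = 0
exponent N       = 1
exponent (p ⊕ q) = exponent p + exponent q
exponent (p ⊗ q) = exponent p + exponent q

⟦⟧≤monomial : ∀ p x → 1 ≤ x → ⟦ p ⟧ x ≤ coefficient p * x ^ exponent p
⟦⟧≤monomial (con c) x 1≤x = ≤-reflexive (sym (*-identityʳ c))
⟦⟧≤monomial N x 1≤x = ≤-reflexive (sym (trans (*-identityˡ _) (*-identityʳ x)))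
⟦⟧≤monomial (p ⊕ q) x@(suc _) 1≤x = begin
  ⟦ p ⟧ x + ⟦ q ⟧ x
    ≤⟨ +-mono-≤ (⟦⟧≤monomial p x 1≤x) (⟦⟧≤monomial q x 1≤x) ⟩
  coefficient p * x ^ exponent p + coefficient q * x ^ exponent q
    ≤⟨ +-mono-≤ (*-monoʳ-≤ (coefficient p) (^-monoʳ-≤ x (m≤m+n (exponent p) (exponent q))))
                (*-monoʳ-≤ (coefficient q) (^-monoʳ-≤ x (m≤n+m (exponent q) (exponent p)))) ⟩
  coefficient p * x ^ (exponent p + exponent q) + coefficient q * x ^ (exponent p + exponent q)
    ≡⟨ *-distribʳ-+ (x ^ (exponent p + exponent q)) (coefficient p) (coefficient q) ⟨
  (coefficient p + coefficient q) * x ^ (exponent p + exponent q) ∎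
  where open ≤-Reasoning
⟦⟧≤monomial (p ⊗ q) x 1≤x = begin
  ⟦ p ⟧ x * ⟦ q ⟧ x
    ≤⟨ *-mono-≤ (⟦⟧≤monomial p x 1≤x) (⟦⟧≤monomial q x 1≤x) ⟩
  (coefficient p * x ^ exponent p) * (coefficient q * x ^ exponent q)
    ≡⟨ interchange (coefficient p) (x ^ exponent p) (coefficient q) (x ^ exponent q) ⟩
  (coefficient p * coefficient q) * (x ^ exponent p * x ^ exponent q)
    ≡⟨ cong ((coefficient p * coefficient q) *_) (^-distribˡ-+-* x (exponent p) (exponent q)) ⟨
  (coefficient p * coefficient q) * x ^ (exponent p + exponent q) ∎
  where
  open ≤-Reasoning
  interchange : ∀ a b c d → (a * b) * (c * d) ≡ (a * c) * (b * d)
  interchange = solve-∀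

⟦⟧-mono : ∀ p {x y} → x ≤ y → ⟦ p ⟧ x ≤ ⟦ p ⟧ y
⟦⟧-mono (con c) x≤y = ≤-refl
⟦⟧-mono N       x≤y = x≤y
⟦⟧-mono (p ⊕ q) x≤y = +-mono-≤ (⟦⟧-mono p x≤y) (⟦⟧-mono q x≤y)
⟦⟧-mono (p ⊗ q) x≤y = *-mono-≤ (⟦⟧-mono p x≤y) (⟦⟧-mono q x≤y)

monomial : ℕ → ℕ → Polynomial
monomial c k = replicate k 0 ++ c ∷ []

eval-monomial : ∀ c k x → eval (monomial c k) x ≡ c * x ^ k
eval-monomial c zero    x = trans (cong (c +_) (*-zeroʳ x)) (trans (+-identityʳ c) (sym (*-identityʳ c)))
eval-monomial c (suc k) x = trans (cong (x *_) (eval-monomial c k x)) (swap x c (x ^ k))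
  where
  swap : ∀ x c y → x * (c * y) ≡ c * (x * y)
  swap = solve-∀

toPolynomial : Cost → Polynomial
toPolynomial p = monomial (coefficient p) (exponent p)

⟦⟧≤eval : ∀ p {x} → 1 ≤ x → ⟦ p ⟧ x ≤ eval (toPolynomial p) x
⟦⟧≤eval p {x} 1≤x = ≤-trans (⟦⟧≤monomial p x 1≤x)
  (≤-reflexive (sym (eval-monomial (coefficient p) (exponent p) x)))

length-clause≤ : ∀ {V : Set} {Ψ : CNF V} {C} → C ∈ Ψ → length C ≤ ∣ Ψ ∣
length-clause≤ {Ψ = C ∷ Ψ} (here refl) = m≤m+n (length C) ∣ Ψ ∣
length-clause≤ {Ψ = D ∷ Ψ} (there i)   = ≤-trans (length-clause≤ i) (m≤n+m ∣ Ψ ∣ (length D))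

-- Derived rules under a hypothesis

module Frege {V : Set} (Ψ : CNF V) where

  infix 3 _⊢_#_
  infixl 9 _·_
  infixl 8 _≫_

  Bounded : Form V → Form V → ℕ → Set
  Bounded H A c = Σ (Tree (clauseForms Ψ) (H ⇒ A)) λ t → treeSize t ≤ c

  -- The record keeps the cost as an index that unification can read off; `Bounded` shows only its
  -- value at the size of `Ψ`.
  record _⊢_#_ (H A : Form V) (p : Cost) : Set where
    constructor bounded
    field proof : Bounded H A (⟦ p ⟧ ∣ Ψ ∣)

  open _⊢_#_ public

  private variable
    H G A B C : Form V
    p q : Cost

  applyᵇ : ∀ {c d} → Bounded H (A ⇒ B) c → Bounded H A d → Bounded H B (3 + (c + d))
  applyᵇ {c = c} {d} (t , t≤) (u , u≤) =
    mp (mp (axiom (S _ _ _)) t) u ,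
    s≤s (s≤s (s≤s (+-mono-≤ t≤ u≤)))

  _·_ : H ⊢ A ⇒ B # p → H ⊢ A # q → H ⊢ B # con 3 ⊕ (p ⊕ q)
  bounded f · bounded a = bounded (applyᵇ f a)

  axiom₁ : Axiom (H ⇒ A) → H ⊢ A # con 1
  axiom₁ a = bounded (axiom a , ≤-refl)

  constᵇ : ∀ {c} (t : Tree (clauseForms Ψ) A) → treeSize t ≤ c → Bounded H A (2 + c)
  constᵇ t t≤ = mp (axiom (K _ _)) t , s≤s (s≤s t≤)

  byAxiom : Axiom A → H ⊢ A # con 3
  byAxiom a = bounded (constᵇ (axiom a) ≤-refl)

  weaken : A ⊢ B # p → H ⊢ A ⇒ B # con 2 ⊕ p
  weaken (bounded (t , t≤)) = bounded (constᵇ t t≤)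

  _≫_ : H ⊢ A # p → A ⊢ B # q → H ⊢ B # con 3 ⊕ ((con 2 ⊕ q) ⊕ p)
  a ≫ f = weaken f · a

  -- The combinator `S K K`: three axioms and two applications of modus ponens.
  assumption : H ⊢ H # con 5
  assumption {H} = bounded (applyᵇ {B = H} {c = 1} {d = 1}
    (axiom (K H (H ⇒ H)) , ≤-refl) (axiom (K H H) , ≤-refl))

  -- The outermost hypothesis is a tautology, so its own five-line proof removes it.
  discharge : ⊥ ⇒ ⊥ ⊢ A # p →
    Σ (Tree (clauseForms Ψ) A) λ t → treeSize t ≤ ⟦ con 1 ⊕ (p ⊕ con 5) ⟧ ∣ Ψ ∣
  discharge (bounded (t , t≤)) with bounded (u , u≤) ← assumption {⊥} =
    mp t u , s≤s (+-mono-≤ t≤ u≤)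

  last : H ∧ A ⊢ A # con 1
  last = axiom₁ (snd _ _)

  lift : H ⊢ A # p → H ∧ B ⊢ A # _
  lift a = axiom₁ (fst _ _) ≫ a

  distribute : A ⊢ B ⇒ C # p → A ⇒ B ⊢ A ⇒ C # con 2 ⊕ p
  distribute (bounded (t , t≤)) = bounded (mp (axiom (S _ _ _)) t , s≤s (s≤s t≤))

  -- The deduction theorem at constant overhead. A conjunction serves as the extended context:
  -- `last` reads its newest member and `lift` reaches the older ones.
  curry : H ∧ A ⊢ B # p → H ⊢ A ⇒ B # _
  curry f = axiom₁ (pair _ _) ≫ distribute (weaken f)

  exFalso : ⊥ ⊢ A # _
  exFalso = axiom₁ (K _ _) ≫ axiom₁ (dne _)

  relaxˡ : H ⊢ A # p → H ⊢ A # p ⊕ q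
  relaxˡ (bounded (t , t≤)) = bounded (t , ≤-trans t≤ (m≤m+n _ _))

  relaxʳ : H ⊢ A # q → H ⊢ A # p ⊕ q
  relaxʳ (bounded (t , t≤)) = bounded (t , ≤-trans t≤ (m≤n+m _ _))

  -- The case distinction is made outside the formal proof, so it adds no lines; the sum is merely a
  -- common bound for both branches.
  decide : ∀ {P : Set} → Dec P → (P → H ⊢ A # p) → ((P → Empty.⊥) → H ⊢ A # q) → H ⊢ A # p ⊕ q
  decide (yes x) f g = relaxˡ (f x)
  decide (no ¬x) f g = relaxʳ (g ¬x)

  cast : A ≡ B → H ⊢ A # p → H ⊢ B # p
  cast refl a = a

  contra : H ⊢ A # p → H ⊢ ¬ A ⇒ B # _
  contra a = curry (last · lift a ≫ exFalso)

  -- Case distinction over the literals of a clause, of which there are at most `N`. Each literal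
  -- costs 9 lines beyond its branch, the final `⊥` costs 9, and quoting and applying the clause
  -- costs 6.
  resolve : ∀ {C} → C ∈ Ψ → (∀ {ℓ} → ℓ ∈ C → H ⊢ literalForm ℓ ⇒ A # p) →
    H ⊢ A # con 15 ⊕ N ⊗ (con 9 ⊕ p)
  resolve {H} {A} {p} {C} C∈Ψ f = bounded (weakenᵇ
    (applyᵇ (cases C (λ i → proof (f i))) (constᵇ (hyp (∈-map⁺ clauseForm C∈Ψ)) ≤-refl)))
    where
    cases : ∀ {c} C → (∀ {ℓ} → ℓ ∈ C → Bounded H (literalForm ℓ ⇒ A) c) →
      Bounded H (clauseForm C ⇒ A) (9 + length C * (9 + c))
    cases []      f = proof (weaken exFalso)
    cases {c} (ℓ ∷ C) f =
      let t , t≤ = applyᵇ (applyᵇ (proof (byAxiom (case _ _ _))) (f (here refl))) (cases C (f ∘ there)) in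
      t , ≤-trans t≤ (≤-reflexive (arith c (length C * (9 + c))))
      where
      arith : ∀ c d → 3 + ((3 + (3 + c)) + (9 + d)) ≡ 9 + ((9 + c) + d)
      arith = solve-∀
    weakenᵇ : Bounded H A (3 + ((9 + length C * (9 + ⟦ p ⟧ ∣ Ψ ∣)) + 3)) →
      Bounded H A (15 + ∣ Ψ ∣ * (9 + ⟦ p ⟧ ∣ Ψ ∣))
    weakenᵇ (t , t≤) = t , ≤-trans t≤ (≤-trans (≤-reflexive (arith (length C * (9 + ⟦ p ⟧ ∣ Ψ ∣))))
      (+-monoʳ-≤ 15 (*-monoˡ-≤ (9 + ⟦ p ⟧ ∣ Ψ ∣) (length-clause≤ C∈Ψ))))
      where
      arith : ∀ d → 3 + ((9 + d) + 3) ≡ 15 + d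
      arith = solve-∀

  -- A chain of modus ponens. Its intermediate counts depend on `k` and are thus no `Cost`; the
  -- bound `k ≤ N` turns the final count into one.
  descend : ∀ (F : ℕ → Form V) k → k ≤ ∣ Ψ ∣ → (∀ j → j < k → H ⊢ F (suc j) ⇒ F j # p) →
    H ⊢ F k # q → H ⊢ F 0 # q ⊕ N ⊗ (con 3 ⊕ p)
  descend {H} {p} {q} F k k≤ f (bounded a) =
    let t , t≤ = go k f a in
    bounded (t , ≤-trans t≤ (+-monoʳ-≤ (⟦ q ⟧ ∣ Ψ ∣) (*-monoˡ-≤ (3 + ⟦ p ⟧ ∣ Ψ ∣) k≤)))
    where
    go : ∀ {c} k → (∀ j → j < k → H ⊢ F (suc j) ⇒ F j # p) → Bounded H (F k) c →
      Bounded H (F 0) (c + k * (3 + ⟦ p ⟧ ∣ Ψ ∣))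
    go {c} zero    f (t , t≤) = t , ≤-trans t≤ (m≤m+n c 0)
    go {c} (suc k) f a =
      let t , t≤ = go k (λ j j<k → f j (m<n⇒m<1+n j<k)) (applyᵇ (proof (f k ≤-refl)) a) in
      t , ≤-trans t≤ (≤-reflexive (arith c (⟦ p ⟧ ∣ Ψ ∣) (k * (3 + ⟦ p ⟧ ∣ Ψ ∣))))
      where
      arith : ∀ c d e → 3 + (d + c) + e ≡ c + ((3 + d) + e)
      arith = solve-∀

-- The clauses of GS as inference rules

∈-allVecs : ∀ {A : Set} {xs : List A} → (∀ x → x ∈ xs) → ∀ {n} (v : Vec A n) → v ∈ allVecs xs n
∈-allVecs all []      = here refl
∈-allVecs all (x ∷ v) = ∈-cartesianProductWith⁺ _∷_ (all x) (∈-allVecs all v)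

∈-mapMaybe : ∀ {A B : Set} {f : A → Maybe B} {x y xs} → x ∈ xs → f x ≡ just y → y ∈ mapMaybe f xs
∈-mapMaybe {f = f} {xs = x ∷ xs} (here refl) eq with f x
∈-mapMaybe (here refl) refl | just y = here refl
∈-mapMaybe {f = f} {xs = x ∷ xs} (there i) eq with f x
... | just _  = there (∈-mapMaybe i eq)
... | nothing = ∈-mapMaybe i eq

toRanking-objects : ∀ {m} (π : Ranking m) → toRanking (Ranking.objects π) ≡ just π
toRanking-objects (ranking v u) with allPairs? (λ x y → ¬? (x ≟ y)) v
... | yes _  = refl
... | no  ¬u = contradiction-irr u ¬u

∈-rankings : ∀ {m} (π : Ranking m) → π ∈ rankings m
∈-rankings π = ∈-mapMaybe (∈-allVecs ∈-allFin (Ranking.objects π)) (toRanking-objects π)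

∈-profiles : ∀ {m n} (R : Profile m n) → R ∈ profiles m n
∈-profiles = ∈-allVecs ∈-rankings

length≤∣∣ : ∀ {V : Set} {Ψ : CNF V} → All (λ C → 1 ≤ length C) Ψ → length Ψ ≤ ∣ Ψ ∣
length≤∣∣ []       = z≤n
length≤∣∣ (l ∷ ls) = +-mono-≤ l (length≤∣∣ ls)

nonempty : ∀ {A : Set} {x : A} {xs} → x ∈ xs → 1 ≤ length xs
nonempty (here _)  = s≤s z≤n
nonempty (there _) = s≤s z≤n

All-map : ∀ {A B : Set} {P : B → Set} {f : A → B} xs → (∀ x → P (f x)) → All P (map f xs)
All-map xs p = All.map⁺ (All.universal p xs)

All-concatMap : ∀ {A B : Set} {P : B → Set} {f : A → List B} xs →
  (∀ x → All P (f x)) → All P (concatMap f xs)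
All-concatMap xs p = All.concat⁺ (All-map xs p)

All-cartesianProductWith : ∀ {A B C : Set} {P : C → Set} {f : A → B → C} xs ys →
  (∀ x y → P (f x y)) → All P (cartesianProductWith f xs ys)
All-cartesianProductWith []       ys p = []
All-cartesianProductWith (x ∷ xs) ys p =
  All.++⁺ (All-map ys (p x)) (All-cartesianProductWith xs ys p)

module _ {m n : ℕ} where

  -- Writing the number of objects as a successor supplies the `NonZero` instance.
  GS⁺ : CNF (Var (suc m) n)
  GS⁺ = GS (suc m) n

  someObject∈ : ∀ (R : Profile (suc m) n) → map (λ o → pos (R , o)) (allFin (suc m)) ∈ GS⁺
  someObject∈ R = ∈-++⁺ˡ (∈-map⁺ _ (∈-profiles R))

  atMostOneObject∈ : ∀ (R : Profile (suc m) n) {a b} → a ≢ b →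
    neg (R , a) ∷ neg (R , b) ∷ [] ∈ GS⁺
  atMostOneObject∈ R {a} {b} a≢b =
    ∈-++⁺ʳ (someObject _ _) (∈-++⁺ˡ (∈-cartesianProductWith⁺
      (λ R (o₁ , o₂) → neg (R , o₁) ∷ neg (R , o₂) ∷ [])
      (∈-profiles R)
      (∈-filter⁺ (λ (o₁ , o₂) → ¬? (o₁ ≟ o₂)) (∈-cartesianProduct⁺ (∈-allFin a) (∈-allFin b)) a≢b)))

  nonDictatorship∈ : ∀ i →
    map (λ R → neg (R , top (lookup R i))) (profiles (suc m) n) ∈ GS⁺
  nonDictatorship∈ i = ∈-++⁺ʳ (someObject _ _) (∈-++⁺ʳ (atMostOneObject _ _)
    (∈-++⁺ˡ (∈-map⁺ _ (∈-allFin i))))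

  onto∈ : ∀ o → map (λ R → pos (R , o)) (profiles (suc m) n) ∈ GS⁺
  onto∈ o = ∈-++⁺ʳ (someObject _ _) (∈-++⁺ʳ (atMostOneObject _ _)
    (∈-++⁺ʳ (nonDictatorship _ _) (∈-++⁺ˡ (∈-map⁺ _ (∈-allFin o)))))

  strategyproofness∈ : ∀ (R : Profile (suc m) n) o i π →
    neg (R , o) ∷ map (λ o′ → pos (s i R π , o′)) (pr i o R) ∈ GS⁺
  strategyproofness∈ R o i π = ∈-++⁺ʳ (someObject _ _) (∈-++⁺ʳ (atMostOneObject _ _)
    (∈-++⁺ʳ (nonDictatorship _ _) (∈-++⁺ʳ (onto _ _)
      (∈-concatMap⁺ _ (Any.map (λ { refl →
        ∈-concatMap⁺ _ (Any.map (λ { refl →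
          ∈-concatMap⁺ _ (Any.map (λ { refl → ∈-map⁺ _ (∈-rankings π) }) (∈-allFin i)) })
        (∈-allFin o)) }) (∈-profiles R))))))

  GS-nonempty : All (λ C → 1 ≤ length C) GS⁺
  GS-nonempty =
    All.++⁺ {xs = someObject _ _} (All-map (profiles (suc m) n) λ _ → s≤s z≤n)
    (All.++⁺ {xs = atMostOneObject _ _}
      (All-cartesianProductWith (profiles (suc m) n) (distinctPairs (suc m) n) λ _ _ → s≤s z≤n)
    (All.++⁺ {xs = nonDictatorship _ _} (All-map (allFin n) perProfile)
    (All.++⁺ {xs = onto _ _} (All-map (allFin (suc m)) perProfile)
      (All-concatMap (profiles (suc m) n) λ R →
        All-concatMap (allFin (suc m)) λ o →
          All-concatMap (allFin n) λ i →
            All-map (rankings (suc m)) λ π → s≤s z≤n))))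
    where
    perProfile : ∀ {A : Set} {f : A → Profile (suc m) n → Literal (Var (suc m) n)} x →
      1 ≤ length (map (f x) (profiles (suc m) n))
    perProfile {f = f} x = ≤-trans (nonempty (∈-profiles (Vec.replicate n identity)))
      (≤-reflexive (sym (length-map (f x) (profiles (suc m) n))))

  clauses≤∣GS∣ : length GS⁺ ≤ ∣ GS⁺ ∣
  clauses≤∣GS∣ = length≤∣∣ GS-nonempty

  -- There is one non-dictatorship clause per agent, and no clause is empty. This bounds every
  -- descent along the agents.
  agents≤∣GS∣ : n ≤ ∣ GS⁺ ∣
  agents≤∣GS∣ = ≤-trans (≤-reflexive (sym (trans (length-map _ (allFin n)) (length-tabulate id))))
    (≤-trans (middle (someObject (suc m) n) (atMostOneObject (suc m) n) (nonDictatorship (suc m) n))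
      clauses≤∣GS∣)
    where
    middle : ∀ {A : Set} (xs ys zs : List A) {ws} → length zs ≤ length (xs ++ ys ++ zs ++ ws)
    middle (x ∷ xs) ys zs = ≤-trans (middle xs ys zs) (n≤1+n _)
    middle [] (y ∷ ys) zs = ≤-trans (middle [] ys zs) (n≤1+n _)
    middle [] [] zs {ws}  = ≤-trans (m≤m+n _ (length ws)) (≤-reflexive (sym (length-++ zs)))

  1≤∣GS∣ : 1 ≤ ∣ GS⁺ ∣
  1≤∣GS∣ = ≤-trans (nonempty (onto∈ zero)) clauses≤∣GS∣

infix 3 _⊢GS_#_

_⊢GS_#_ : ∀ {m n} → Form (Var (suc m) n) → Form (Var (suc m) n) → Cost → Set
_⊢GS_#_ {m} {n} H A p = Frege._⊢_#_ (GS (suc m) n) H A p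

open module GSRules {m n} = Frege (GS (suc m) n)
  using (_·_; discharge; last; lift; curry; decide; cast; contra; resolve; descend)

private variable
  m n : ℕ
  p q : Cost

X : Profile m n → Fin m → Form (Var m n)
X R o = var (R , o)

module _ {m n : ℕ} {H A : Form (Var (suc m) n)} where

  outcome : ∀ R → (∀ o → H ⊢GS X R o ⇒ A # p) → H ⊢GS A # _
  outcome R f = resolve (someObject∈ R) λ ℓ∈ → elim (∈-map⁻ _ ℓ∈)
    where
    elim : ∀ {ℓ} → ∃ (λ o → o ∈ allFin (suc m) × ℓ ≡ pos (R , o)) → H ⊢GS literalForm ℓ ⇒ A # _
    elim (o , _ , refl) = f o

  conflict : ∀ R {a b} → a ≢ b → H ⊢GS X R a # p → H ⊢GS X R b # q → H ⊢GS A # _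
  conflict {p = p} {q} R {a} {b} a≢b x y = resolve (atMostOneObject∈ R a≢b) elim
    where
    elim : ∀ {ℓ} → ℓ ∈ neg (R , a) ∷ neg (R , b) ∷ [] → H ⊢GS literalForm ℓ ⇒ A # _
    elim (here refl)         = Frege.relaxˡ _ (contra x)
    elim (there (here refl)) = Frege.relaxʳ _ (contra y)

  -- Strategyproofness as a case distinction: after agent `i` misreports `π`, only outcomes weakly
  -- below `a` in the original ranking remain.
  truthful : ∀ R i π {a} → H ⊢GS X R a # p →
    (∀ o → a ≽[ lookup R i ] o → H ⊢GS X (s i R π) o ⇒ A # q) → H ⊢GS A # _
  truthful R i π {a} x f = resolve (strategyproofness∈ R a i π) λ where
      (here refl) → Frege.relaxˡ _ (contra x)
      (there ℓ∈)  → Frege.relaxʳ _ (elim (∈-map⁻ _ ℓ∈))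
    where
    elim : ∀ {ℓ} → ∃ (λ o → o ∈ pr i a R × ℓ ≡ pos (s i R π , o)) → H ⊢GS literalForm ℓ ⇒ A # _
    elim (o , o∈ , refl) =
      f o (proj₂ (∈-filter⁻ (λ o → lookup R i ⁻¹⟨ a ⟩ ≤? lookup R i ⁻¹⟨ o ⟩) {xs = allFin (suc m)} o∈))

  attained : ∀ a → (∀ R → H ⊢GS X R a ⇒ A # p) → H ⊢GS A # _
  attained a f = resolve (onto∈ a) λ ℓ∈ → elim (∈-map⁻ _ ℓ∈)
    where
    elim : ∀ {ℓ} → ∃ (λ R → R ∈ profiles (suc m) n × ℓ ≡ pos (R , a)) → H ⊢GS literalForm ℓ ⇒ A # _
    elim (R , _ , refl) = f R

  -- To reach a contradiction it suffices that agent `i` always obtains the top object.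
  nonDictator : ∀ i → (∀ R → H ⊢GS X R (top (lookup R i)) # p) → H ⊢GS A # _
  nonDictator i f = resolve (nonDictatorship∈ i) λ ℓ∈ → elim (∈-map⁻ _ ℓ∈)
    where
    elim : ∀ {ℓ} → ∃ (λ R → R ∈ profiles (suc m) n × ℓ ≡ neg (R , top (lookup R i))) →
      H ⊢GS literalForm ℓ ⇒ A # _
    elim (R , _ , refl) = contra (f R)

-- Decisive groups

merge : ∀ {A : Set} → (Fin n → Bool) → (Fin n → A) → (Fin n → A) → Vec A n
merge T f g = tabulate λ i → if T i then f i else g i

lookup-merge : ∀ {A : Set} (P : A → Set) T {f g : Fin n → A} i →
  (T i ≡ true → P (f i)) → (T i ≡ false → P (g i)) → P (lookup (merge T f g) i)
lookup-merge P T {f} {g} i y z =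
  subst P (sym (lookup∘tabulate (λ i → if T i then f i else g i) i)) (cases (T i) y z)
  where
  cases : ∀ b → (b ≡ true → P (f i)) → (b ≡ false → P (g i)) → P (if b then f i else g i)
  cases true  y z = y refl
  cases false y z = z refl

≡-tabulate : ∀ {A : Set} {v : Vec A n} {f : Fin n → A} → (∀ i → f i ≡ lookup v i) → tabulate f ≡ v
≡-tabulate {v = v} eq = trans (tabulate-cong eq) (tabulate∘lookup v)

not-true : ∀ {b} → not b ≡ true → b ≡ false
not-true = not-injective

not-false : ∀ {b} → not b ≡ false → b ≡ true
not-false = not-injective

initial : ℕ → Fin n → Bool
initial k i = toℕ i <ᵇ k

<ᵇ-suc : ∀ i j → i ≢ j → (i <ᵇ suc j) ≡ (i <ᵇ j)
<ᵇ-suc zero    zero    i≢j = contradiction refl i≢j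
<ᵇ-suc zero    (suc j) i≢j = refl
<ᵇ-suc (suc i) zero    i≢j = refl
<ᵇ-suc (suc i) (suc j) i≢j = <ᵇ-suc i j (i≢j ∘ cong suc)

n<ᵇn : ∀ n → (n <ᵇ n) ≡ false
n<ᵇn zero    = refl
n<ᵇn (suc n) = n<ᵇn n

n<ᵇ1+n : ∀ n → (n <ᵇ suc n) ≡ true
n<ᵇ1+n zero    = refl
n<ᵇ1+n (suc n) = n<ᵇ1+n n

initial-all : ∀ (i : Fin n) → initial n i ≡ true
initial-all i = Equivalence.to T-≡ (<⇒<ᵇ (toℕ<n i))

initial-suc : ∀ {j} (j<n : j < n) i → i ≢ fromℕ< j<n → initial (suc j) i ≡ initial j i
initial-suc {j = j} j<n i i≢ = <ᵇ-suc (toℕ i) j λ eq →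
  i≢ (toℕ-injective (trans eq (sym (toℕ-fromℕ< j<n))))

merge-initial-all : ∀ {A : Set} (v w : Vec A n) → merge (initial n) (lookup v) (lookup w) ≡ v
merge-initial-all v w = ≡-tabulate λ i →
  cong (λ b → if b then lookup v i else lookup w i) (initial-all i)

-- Consecutive hybrids of `v` and `w` differ at a single agent, so one deviation leads from each to
-- the next.
merge-initial-suc : ∀ {A : Set} (v w : Vec A n) {j} (j<n : j < n) →
  merge (initial (suc j)) (lookup v) (lookup w) [ fromℕ< j<n ]≔ lookup w (fromℕ< j<n) ≡
  merge (initial j) (lookup v) (lookup w)
merge-initial-suc v w {j} j<n = sym (≡-tabulate eq)
  where
  eq : ∀ i → (if initial j i then lookup v i else lookup w i) ≡
    lookup (merge (initial (suc j)) (lookup v) (lookup w) [ fromℕ< j<n ]≔ lookup w (fromℕ< j<n)) i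
  eq i with i ≟ fromℕ< j<n
  ... | yes refl
    rewrite lookup∘update (fromℕ< j<n) (merge (initial (suc j)) (lookup v) (lookup w))
              (lookup w (fromℕ< j<n))
          | toℕ-fromℕ< j<n | n<ᵇn j = refl
  ... | no i≢
    rewrite lookup∘update′ i≢ (merge (initial (suc j)) (lookup v) (lookup w))
              (lookup w (fromℕ< j<n))
          | lookup∘tabulate (λ i → if initial (suc j) i then lookup v i else lookup w i) i
          | initial-suc j<n i i≢ = refl

-- Monotonicity and decisive groups

module _ {m n : ℕ} {H : Form (Var (suc m) n)} where

  -- Let `o` be the outcome after the deviation. Truthfulness at `R` gives `a` weakly above `o`,
  -- hence also in `π`. If `o` differs from `a`, deviating back from `π` must yield something weakly
  -- below `o` in `π`; but it yields `a`, so antisymmetry gives a contradiction.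
  monotonic-step : ∀ {R i π a} → Monotonic a (lookup R i) π → H ⊢GS X R a ⇒ X (s i R π) a # _
  monotonic-step {R} {i} {π} {a} mon = curry (truthful R i π last λ o a≽o →
    decide (o ≟ a)
      (λ eq → cast (cong (λ o → X _ o ⇒ X _ a) (sym eq)) (curry last))
      (λ o≢a → curry (truthful (s i R π) i (lookup R i) last λ o′ o≽o′ →
        curry (conflict R {a} {o′}
          (λ { refl → o≢a (≽-antisym π (subst (o ≽[_] a) (lookup∘update i R π) o≽o′) (mon o a≽o)) })
          (lift (lift last))
          (cast (cong (λ R → X R o′) restore) last)))))
    where
    restore : s i (s i R π) (lookup R i) ≡ R
    restore = trans ([]≔-idempotent R i) ([]≔-lookup R i)

  -- A hybrid argument that switches the agents from `R` to `R′` one at a time, beginning with the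
  -- last one.
  monotonicity : ∀ {R R′ : Profile (suc m) n} {a} → (∀ i → Monotonic a (lookup R i) (lookup R′ i)) →
    H ⊢GS X R a # p → H ⊢GS X R′ a # _
  monotonicity {p = p} {R} {R′} {a} mon x =
    -- No number is below 0, so the hybrid for `initial 0` computes to the tabulation of `R′`.
    cast (cong (λ R → X R a) (tabulate∘lookup R′))
      (descend (λ k → X (merge (initial k) (lookup R) (lookup R′)) a) n agents≤∣GS∣ step
        (cast (cong (λ R → X R a) (sym (merge-initial-all R R′))) x))
    where
    step : ∀ j → j < n →
      H ⊢GS X (merge (initial (suc j)) (lookup R) (lookup R′)) a ⇒
            X (merge (initial j) (lookup R) (lookup R′)) a # _
    step j j<n = cast
      (cong (λ Q → X (merge (initial (suc j)) (lookup R) (lookup R′)) a ⇒ X Q a)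
        (merge-initial-suc R R′ j<n))
      (monotonic-step (subst (λ π → Monotonic a π (lookup R′ i)) (sym R≡) (mon i)))
      where
      i = fromℕ< j<n
      R≡ : lookup (merge (initial (suc j)) (lookup R) (lookup R′)) i ≡ lookup R i
      R≡ = lookup-merge (_≡ lookup R i) (initial (suc j)) i (λ _ → refl)
        λ eq → contradiction (trans (sym eq) (trans (cong (_<ᵇ suc j) (toℕ-fromℕ< j<n)) (n<ᵇ1+n j))) λ ()

  Decisive : (Fin n → Bool) → Fin (suc m) → Cost → Set
  Decisive T y p = ∀ R → (∀ i → T i ≡ true → Top y (lookup R i)) → H ⊢GS X R y # p

module _ {m n : ℕ} {H : Form (Var (suc m) n)} where

  -- The onto clause gives some profile with outcome `y`; moving `y` to the top everywhere shrinks
  -- no lower contour set of `y`.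
  unanimity : ∀ {R y} → (∀ i → Top y (lookup R i)) → H ⊢GS X R y # _
  unanimity {R} {y} tops = attained y λ R₀ →
    curry (monotonicity {R = R₀} {R} (λ i o _ → tops i o) last)

module _ {m n : ℕ} {H A : Form (Var (suc m) n)} where

  -- Let `T` raise `y` to the top. Since `y` was already above `x` for these agents, `x` would
  -- persist, whereas decisiveness forces `y`.
  improvement : ∀ T {y x R} → Decisive {H = H} T y p → y ≢ x →
    (∀ i → T i ≡ true → y ≽[ lookup R i ] x) → H ⊢GS X R x ⇒ A # _
  improvement T {y} {x} {R} dec y≢x y≽x = curry (conflict R′ y≢x
    (lift (dec R′ λ i Ti → lookup-merge (Top y) T i (λ _ → raise-Top y (lookup R i))
      λ ¬Ti → contradiction (trans (sym Ti) ¬Ti) λ ()))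
    (monotonicity {R = R} {R′} (λ i → lookup-merge (Monotonic x (lookup R i)) T i
      (λ Ti o x≽o → Equivalence.from
        (raise-≽ (lookup R i) (≢-sym y≢x)
          λ { refl → y≢x (≽-antisym (lookup R i) (y≽x i Ti) x≽o) })
        x≽o)
      (λ _ o x≽o → x≽o)) last))
    where
    R′ = merge T (raise y ∘ lookup R) (lookup R)

  -- By unanimity, the group of all agents is decisive for every object.
  pareto : ∀ {y x R} → y ≢ x → (∀ i → y ≽[ lookup R i ] x) → H ⊢GS X R x ⇒ A # _
  pareto y≢x y≽x = improvement (const true) (λ R tops → unanimity {R = R} λ i → tops i refl) y≢x
    (λ i _ → y≽x i)

  outcome₂ : ∀ R a b → (∀ o → o ≢ a → ∀ i → b ≽[ lookup R i ] o) →
    H ⊢GS X R a ⇒ A # p → H ⊢GS X R b ⇒ A # q → H ⊢GS A # _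
  outcome₂ R a b b≽ f g = outcome R λ o →
    decide (o ≟ a) (λ eq → cast (cong (λ o → X R o ⇒ A) (sym eq)) f) λ o≢a →
    decide (o ≟ b) (λ eq → cast (cong (λ o → X R o ⇒ A) (sym eq)) g) λ o≢b →
    pareto (≢-sym o≢b) (b≽ o o≢a)

module _ {m n : ℕ} {H : Form (Var (suc m) n)} where

  -- The profile `Q` interpolates between `P` and the given `R`: inside `T` it follows `P`, outside
  -- it follows `R` with `b` raised. Only `a` and `b` are Pareto optimal candidates there. Outcome
  -- `b` would carry over to `P`, where `a` is chosen; so `Q` yields `a`, which carries over to `R`.
  decisiveness : ∀ P T {a b} → a ≢ b →
    (∀ i → T i ≡ true → ∀ o → o ≢ a → b ≽[ lookup P i ] o) →
    (∀ i → T i ≡ false → Top b (lookup P i)) →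
    H ⊢GS X P a # p → Decisive {H = H} T a _
  decisiveness P T {a} {b} a≢b inside outside x R tops = monotonicity {R = Q} {R}
    (λ i → lookup-merge (λ π → Monotonic a π (lookup R i)) T i
      (λ Ti o _ → tops i Ti o)
      (λ _ o a≽o → Equivalence.to
        (raise-≽ (lookup R i) a≢b λ { refl →
          a≢b (≽-antisym (raise b (lookup R i)) a≽o (raise-Top b (lookup R i) a)) })
        a≽o))
    (outcome₂ Q a b
      (λ o o≢a i → lookup-merge (b ≽[_] o) T i
        (λ Ti → inside i Ti o o≢a)
        (λ _ → raise-Top b (lookup R i) o))
      (curry last)
      (curry (conflict P a≢b (lift x) (monotonicity {R = Q} {P}
        (λ i → lookup-merge (λ π → Monotonic b π (lookup P i)) T i
          (λ _ o b≽o → b≽o)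
          (λ ¬Ti o _ → outside i ¬Ti o))
        last))))
    where
    Q = merge T (lookup P) (raise b ∘ lookup R)

second-≽ : ∀ (a b o : Fin m) π → b ≢ a → o ≢ a → b ≽[ raise a (raise b π) ] o
second-≽ a b o π b≢a o≢a = Equivalence.from (raise-≽ (raise b π) b≢a o≢a) (raise-Top b π o)

third-≽ : ∀ (a b c o : Fin m) π → c ≢ a → c ≢ b → o ≢ a → o ≢ b →
  c ≽[ raise a (raise b (raise c π)) ] o
third-≽ a b c o π c≢a c≢b o≢a o≢b =
  Equivalence.from (raise-≽ (raise b (raise c π)) c≢a o≢a) (second-≽ b c o π c≢b o≢b)

-- Duels of two objects

duel : (Fin n → Bool) → Fin m → Fin m → Profile m n
duel T a b = merge T (λ _ → raise a (raise b identity)) (λ _ → raise b (raise a identity))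

duel-swap : ∀ T (a b : Fin m) → duel {n} (not ∘ T) b a ≡ duel T a b
duel-swap T a b = tabulate-cong λ i → if-not (T i)

duel-Top : ∀ T (a b : Fin m) (i : Fin n) → T i ≡ true → Top a (lookup (duel T a b) i)
duel-Top T a b i Ti = lookup-merge (Top a) T i (λ _ → raise-Top a (raise b identity))
  λ ¬Ti → contradiction (trans (sym Ti) ¬Ti) λ ()

duel-Topᶜ : ∀ T (a b : Fin m) (i : Fin n) → T i ≡ false → Top b (lookup (duel T a b) i)
duel-Topᶜ T a b i ¬Ti = lookup-merge (Top b) T i
  (λ Ti → contradiction (trans (sym Ti) ¬Ti) λ ()) λ _ → raise-Top b (raise a identity)

duel-≽ : ∀ T {a b o : Fin m} → a ≢ b → o ≢ a → (i : Fin n) → b ≽[ lookup (duel T a b) i ] o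
duel-≽ T {a} {b} {o} a≢b o≢a i = lookup-merge (b ≽[_] o) T i
  (λ _ → second-≽ a b o identity (≢-sym a≢b) o≢a) (λ _ → raise-Top b (raise a identity) o)

-- The third object through which decisiveness passes from `a` to `y`.
another : (a y : Fin (3 + m)) → ∃ λ z → z ≢ a × z ≢ y
another zero          zero          = suc zero , (λ ()) , λ ()
another zero          (suc zero)    = suc (suc zero) , (λ ()) , λ ()
another zero          (suc (suc _)) = suc zero , (λ ()) , λ ()
another (suc zero)    zero          = suc (suc zero) , (λ ()) , λ ()
another (suc (suc _)) zero          = suc zero , (λ ()) , λ ()
another (suc _)       (suc _)       = zero , (λ ()) , λ ()

module _ {m n : ℕ} {H : Form (Var (3 + m) n)} where

  -- If T did not win the duel of y against a third object z, then the complement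
  -- of T would be decisive for z while T is decisive for a.
  spread : ∀ T {a b} → a ≢ b → H ⊢GS X (duel T a b) a # p → ∀ y → Decisive {H = H} T y _
  spread {p = p} T {a} {b} a≢b x y R tops =
    decide (y ≟ a)
      (λ eq → cast (cong (λ o → X R o) (sym eq))
        (forA R λ i Ti → subst (λ o → Top o (lookup R i)) eq (tops i Ti)))
      (λ y≢a → viaThird (another a y))
    where
    forA : Decisive {H = H} T a _
    forA = decisiveness (duel T a b) T a≢b (λ i _ o o≢a → duel-≽ T a≢b o≢a i) (duel-Topᶜ T a b) x
    viaThird : ∃ (λ z → z ≢ a × z ≢ y) → H ⊢GS X R y # _
    viaThird (z , z≢a , z≢y) =
      decisiveness (duel T y z) T y≢z (λ i _ o o≢y → duel-≽ T y≢z o≢y i) (duel-Topᶜ T y z)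
        (outcome₂ (duel T y z) y z (λ o o≢y → duel-≽ T y≢z o≢y)
          (curry last)
          (curry (conflict (duel T a z) (≢-sym z≢a)
            (lift (forA (duel T a z) (duel-Top T a z)))
            (decisiveness (duel T y z) (not ∘ T) z≢y
              (λ i ¬Ti o o≢z → subst (λ R → y ≽[ lookup R i ] o) (duel-swap T y z)
                (duel-≽ (not ∘ T) z≢y o≢z i))
              (λ i Ti → duel-Top T y z i (not-false Ti))
              last (duel T a z) λ i ¬Ti → duel-Topᶜ T a z i (not-true ¬Ti)))))
        R tops
      where
      y≢z = ≢-sym z≢y

-- The pivotal agent and the Condorcet cycle

only : Fin n → Fin n → Bool
only i k = does (k ≟ i)

only-true : ∀ {i k : Fin n} → only i k ≡ true → k ≡ i
only-true {i = i} {k} eq with k ≟ i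
only-true eq | yes k≡i = k≡i
only-true () | no _

only-false : ∀ {i k : Fin n} → only i k ≡ false → k ≢ i
only-false {i = i} {k} eq with k ≟ i
only-false () | yes _
only-false eq | no k≢i = k≢i

module _ {m n : ℕ} where

  o₀ o₁ o₂ : Fin (3 + m)
  o₀ = zero
  o₁ = suc zero
  o₂ = suc (suc zero)

  -- A Condorcet cycle: for each of its three objects, two of the three groups of
  -- agents agree that another one is better.
  cycle : (j : ℕ) → Fin n → Profile (3 + m) n
  cycle j i = merge (initial j) (λ _ → raise o₀ (raise o₁ (raise o₂ identity)))
    λ k → if only i k then raise o₁ (raise o₂ (raise o₀ identity))
                      else raise o₂ (raise o₀ (raise o₁ identity))

  lookup-cycle : ∀ (P : Ranking (3 + m) → Set) j (i k : Fin n) →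
    (initial j k ≡ true → P (raise o₀ (raise o₁ (raise o₂ identity)))) →
    (initial j k ≡ false → only i k ≡ true → P (raise o₁ (raise o₂ (raise o₀ identity)))) →
    (initial j k ≡ false → only i k ≡ false → P (raise o₂ (raise o₀ (raise o₁ identity)))) →
    P (lookup (cycle j i) k)
  lookup-cycle P j i k x y z = lookup-merge P (initial j) k x λ ¬init → cases (only i k) (y ¬init) (z ¬init)
    where
    cases : ∀ b → (b ≡ true → P _) → (b ≡ false → P _) → P (if b then _ else _)
    cases true  y z = y refl
    cases false y z = z refl

  cycle-2≽0 : ∀ j (i k : Fin n) → not (initial j k) ≡ true → o₂ ≽[ lookup (cycle j i) k ] o₀
  cycle-2≽0 j i k ¬init = lookup-cycle (o₂ ≽[_] o₀) j i k
    (λ init → contradiction (trans (sym init) (not-true ¬init)) λ ())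
    (λ _ _ → second-≽ o₁ o₂ o₀ (raise o₀ identity) (λ ()) (λ ()))
    (λ _ _ → raise-Top o₂ (raise o₀ (raise o₁ identity)) o₀)

  cycle-0≽1 : ∀ j (i k : Fin n) → not (only i k) ≡ true →
    o₀ ≽[ lookup (cycle j i) k ] o₁
  cycle-0≽1 j i k k≢i = lookup-cycle (o₀ ≽[_] o₁) j i k
    (λ _ → raise-Top o₀ (raise o₁ (raise o₂ identity)) o₁)
    (λ _ k≡i → contradiction (trans (sym k≡i) (not-true k≢i)) λ ())
    (λ _ _ → second-≽ o₂ o₀ o₁ (raise o₁ identity) (λ ()) (λ ()))

  cycle-1≽2 : ∀ {j} (j<n : j < n) k → initial (suc j) k ≡ true →
    o₁ ≽[ lookup (cycle j (fromℕ< j<n)) k ] o₂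
  cycle-1≽2 {j = j} j<n k init = lookup-cycle (o₁ ≽[_] o₂) j (fromℕ< j<n) k
    (λ _ → second-≽ o₀ o₁ o₂ (raise o₂ identity) (λ ()) (λ ()))
    (λ _ _ → raise-Top o₁ (raise o₂ (raise o₀ identity)) o₂)
    (λ ¬init k≢ → contradiction
      (trans (sym init) (trans (initial-suc j<n k (only-false k≢)) ¬init)) λ ())

  -- Lets Pareto dominance exclude every outcome off the cycle.
  cycle-0≽ : ∀ j (i k : Fin n) {o} → o ≢ o₀ → o ≢ o₁ → o ≢ o₂ →
    o₀ ≽[ lookup (cycle j i) k ] o
  cycle-0≽ j i k {o} o≢0 o≢1 o≢2 = lookup-cycle (o₀ ≽[_] o) j i k
    (λ _ → raise-Top o₀ (raise o₁ (raise o₂ identity)) o)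
    (λ _ _ → third-≽ o₁ o₂ o₀ o identity (λ ()) (λ ()) o≢1 o≢2)
    (λ _ _ → second-≽ o₂ o₀ o (raise o₁ identity) (λ ()) o≢2)

  wins loses : (Fin n → Bool) → Form (Var (3 + m) n)
  wins T  = X (duel T o₀ o₁) o₀
  loses T = X (duel T o₀ o₁) o₁

  module _ {H A : Form (Var (3 + m) n)} where

    wins⇒decisive : ∀ T → H ⊢GS wins T # p → ∀ y → Decisive {H = H} T y _
    wins⇒decisive T = spread T {o₀} {o₁} λ ()

    -- A duel lost by `T` is, with the objects exchanged, a duel won by the complement.
    loses⇒decisiveᶜ : ∀ T → H ⊢GS loses T # p → ∀ y → Decisive {H = H} (not ∘ T) y _
    loses⇒decisiveᶜ T x = spread (not ∘ T) {o₁} {o₀} (λ ())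
      (cast (cong (λ R → X R o₁) (sym (duel-swap T o₀ o₁))) x)

    duel-outcome : ∀ T → H ⊢GS wins T ⇒ A # p → H ⊢GS loses T ⇒ A # q → H ⊢GS A # _
    duel-outcome T = outcome₂ (duel T o₀ o₁) o₀ o₁ λ o o≢0 → duel-≽ T (λ ()) o≢0

    -- Winning one duel makes agent `i` alone decisive for every object, in particular for the top
    -- of its own ranking in each profile.
    no-dictator : ∀ i → H ⊢GS wins (only i) # p → H ⊢GS A # _
    no-dictator i x = nonDictator i λ R → wins⇒decisive (only i) x (top (lookup R i)) R
      λ k k≡i → subst (λ k → Top (top (lookup R i)) (lookup R k)) (sym (only-true k≡i))
        (top-Top (lookup R i))

    -- The three duels make the agents up to `j`, those from `j` on, and those other than `j`
    -- decisive. On the cycle they defeat `o₂` by `o₁`, `o₀` by `o₂`, and `o₁` by `o₀`,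
    -- respectively.
    no-cycle : ∀ {j} (j<n : j < n) → H ⊢GS wins (initial (suc j)) # p → H ⊢GS loses (initial j) # q →
      ∀ {r} → H ⊢GS loses (only (fromℕ< j<n)) # r → H ⊢GS A # _
    no-cycle {j = j} j<n x y z = outcome (cycle j i) λ o →
      decide (o ≟ o₀) (λ eq → cast (cong (λ o → X (cycle j i) o ⇒ A) (sym eq))
        (improvement (not ∘ initial j) (loses⇒decisiveᶜ (initial j) y o₂) (λ ()) (cycle-2≽0 j i)))
      λ o≢0 → decide (o ≟ o₁) (λ eq → cast (cong (λ o → X (cycle j i) o ⇒ A) (sym eq))
        (improvement (not ∘ only i) (loses⇒decisiveᶜ (only i) z o₀) (λ ()) (cycle-0≽1 j i)))
      λ o≢1 → decide (o ≟ o₂) (λ eq → cast (cong (λ o → X (cycle j i) o ⇒ A) (sym eq))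
        (improvement (initial (suc j)) (wins⇒decisive (initial (suc j)) x o₁) (λ ()) (cycle-1≽2 j<n)))
      λ o≢2 → pareto (≢-sym o≢0) λ k → cycle-0≽ j i k o≢0 o≢1 o≢2
      where
      i = fromℕ< j<n

  module _ {H A : Form (Var (3 + m) n)} where

    -- If the first `j` agents lost, the agent numbered `j` would be pivotal. Its own duel then
    -- decides between a dictator and the Condorcet cycle.
    no-pivot : ∀ j → j < n → H ⊢GS wins (initial (suc j)) ⇒ wins (initial j) # _
    no-pivot j j<n = curry (duel-outcome (initial j)
      (curry last)
      (curry (duel-outcome (only (fromℕ< j<n))
        (curry (no-dictator (fromℕ< j<n) last))
        (curry (no-cycle j<n (lift (lift last)) (lift last) last)))))

    contradictory : H ⊢GS A # _
    contradictory = conflict (duel (initial 0) o₀ o₁) (λ ())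
      -- Unanimity lets all agents win with `o₀`; descending, the empty group wins as well, although
      -- everyone then ranks `o₁` first.
      (descend (λ j → wins (initial j)) n agents≤∣GS∣ no-pivot
        (unanimity {R = duel (initial n) o₀ o₁} λ i → duel-Top (initial n) o₀ o₁ i (initial-all i)))
      (unanimity {R = duel (initial 0) o₀ o₁} λ i → duel-Topᶜ (initial 0) o₀ o₁ i refl)

-- Abstract, so that the cost, a large term, is never unfolded.
abstract

  uniform-contradiction : ∃ λ p → ∀ m n → _⊢GS_#_ {2 + m} {n} (⊥ ⇒ ⊥) ⊥ p
  uniform-contradiction = _ , λ m n → contradictory

-- The cost is chosen before `m` and `n`, so that one polynomial bounds all refutations.
refutation : ∃ λ p → ∀ m n → Σ (Tree (clauseForms (GS (3 + m) n)) ⊥) λ t →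
  treeSize t ≤ ⟦ p ⟧ ∣ GS (3 + m) n ∣
refutation = con 1 ⊕ (proj₁ uniform-contradiction ⊕ con 5) ,
  λ m n → discharge (proj₂ uniform-contradiction m n)

-- Soundness

-- Disjunction is encoded by de Morgan, which makes every formula stable.
Holds : ∀ {V : Set} → (V → Bool) → Form V → Set
Holds α (var v) = α v ≡ true
Holds α ⊥       = Empty.⊥
Holds α (A ∧ B) = Holds α A × Holds α B
Holds α (A ∨ B) = (Holds α A → Empty.⊥) × (Holds α B → Empty.⊥) → Empty.⊥
Holds α (A ⇒ B) = Holds α A → Holds α B

module _ {V : Set} {α : V → Bool} where

  Holds-stable : ∀ A → Stable (Holds α A)
  Holds-stable (var v) ¬¬h with α v
  ... | true  = refl
  ... | false = Empty.⊥-elim (¬¬h λ ())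
  Holds-stable ⊥       ¬¬h = ¬¬h id
  Holds-stable (A ∧ B) ¬¬h =
    Holds-stable A (λ ¬a → ¬¬h (¬a ∘ proj₁)) , Holds-stable B (λ ¬b → ¬¬h (¬b ∘ proj₂))
  Holds-stable (A ∨ B) ¬¬h n = ¬¬h λ h → h n
  Holds-stable (A ⇒ B) ¬¬h a = Holds-stable B λ ¬b → ¬¬h λ f → ¬b (f a)

  axiom-sound : ∀ {A} → Axiom A → Holds α A
  axiom-sound (K A B)      a b = a
  axiom-sound (S A B C)    f g a = f a (g a)
  axiom-sound (pair A B)   = _,_
  axiom-sound (fst A B)    = proj₁
  axiom-sound (snd A B)    = proj₂
  axiom-sound (inl A B)    a (¬a , _) = ¬a a
  axiom-sound (inr A B)    b (_ , ¬b) = ¬b b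
  axiom-sound (case A B C) f g h = Holds-stable C λ ¬c → h (¬c ∘ f , ¬c ∘ g)
  axiom-sound (dne A)      = Holds-stable A

  sound : ∀ {Γ A} → Tree Γ A → All (Holds α) Γ → Holds α A
  sound (hyp i)   hs = All.lookup hs i
  sound (axiom a) hs = axiom-sound a
  sound (mp t u)  hs = sound t hs (sound u hs)

  clause-holds : ∀ {C} → Any (True α) C → Holds α (clauseForm C)
  clause-holds (here (pos eq)) (¬a , _) = ¬a eq
  clause-holds (here (neg eq)) (¬a , _) = ¬a λ eq′ → contradiction (trans (sym eq) eq′) λ ()
  clause-holds (there i)       (_ , ¬b) = ¬b (clause-holds i)

-- Turns the syntactic refutation into the semantic fact by which a reduction rule preserves
-- satisfiability.
refutable⇒unsatisfiable : ∀ {V : Set} {Ψ : CNF V} → Tree (clauseForms Ψ) ⊥ → Satisfiable Ψ → Empty.⊥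
refutable⇒unsatisfiable t (α , h) = sound t (All.map⁺ (All.map clause-holds h))

-- Change of hypotheses and joint proofs

Tree-⊆ : ∀ {V : Set} {Γ Δ : List (Form V)} → (∀ {A} → A ∈ Γ → A ∈ Δ) → ∀ {A} → Tree Γ A → Tree Δ A
Tree-⊆ Γ⊆Δ (hyp i)   = hyp (Γ⊆Δ i)
Tree-⊆ Γ⊆Δ (axiom a) = axiom a
Tree-⊆ Γ⊆Δ (mp t u)  = mp (Tree-⊆ Γ⊆Δ t) (Tree-⊆ Γ⊆Δ u)

treeSize-⊆ : ∀ {V : Set} {Γ Δ : List (Form V)} (Γ⊆Δ : ∀ {A} → A ∈ Γ → A ∈ Δ) {A} (t : Tree Γ A) →
  treeSize (Tree-⊆ Γ⊆Δ t) ≡ treeSize t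
treeSize-⊆ Γ⊆Δ (hyp i)   = refl
treeSize-⊆ Γ⊆Δ (axiom a) = refl
treeSize-⊆ Γ⊆Δ (mp t u)  = cong suc (cong₂ _+_ (treeSize-⊆ Γ⊆Δ t) (treeSize-⊆ Γ⊆Δ u))

fregeProofs : ∀ {V : Set} {Γ : List (Form V)} {c} → (∀ A → Σ (Tree Γ A) λ t → treeSize t ≤ c) →
  ∀ Δ → Σ (FregeProof Γ Δ) λ π → FregeProof.size π ≤ length Δ * c
fregeProofs f [] = record { lines = [] ; derivation = [] ; derives = [] } , z≤n
fregeProofs f (A ∷ Δ) with f A | fregeProofs f Δ
... | t , t≤ | π , π≤ = record
  { lines      = flatten t ++ lines
  ; derivation = flatten-derivation t ++ᵈ derivation
  ; derives    = ∈-++⁺ˡ (flatten-root t) ∷ All.map (∈-++⁺ʳ (flatten t)) derives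
  } , ≤-trans (≤-reflexive (trans (length-++ (flatten t)) (cong (_+ _) (length-flatten t))))
        (+-mono-≤ t≤ π≤)
  where open FregeProof π

-- The size of GS grows with the number of agents

total : ∀ {A : Set} → (A → ℕ) → List A → ℕ
total f xs = sum (map f xs)

∣map∣ : ∀ {A V : Set} (g : A → Clause V) xs → ∣ map g xs ∣ ≡ total (length ∘ g) xs
∣map∣ g xs = cong sum (sym (map-∘ xs))

∣++∣ : ∀ {V : Set} (Ψ Ψ′ : CNF V) → ∣ Ψ ++ Ψ′ ∣ ≡ ∣ Ψ ∣ + ∣ Ψ′ ∣
∣++∣ Ψ Ψ′ = trans (cong sum (map-++ length Ψ Ψ′)) (sum-++ (map length Ψ) (map length Ψ′))

∣concat∣ : ∀ {V : Set} (Ψs : List (CNF V)) → ∣ concat Ψs ∣ ≡ total ∣_∣ Ψs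
∣concat∣ []       = refl
∣concat∣ (Ψ ∷ Ψs) = trans (∣++∣ Ψ (concat Ψs)) (cong (∣ Ψ ∣ +_) (∣concat∣ Ψs))

∣concatMap∣ : ∀ {A V : Set} (g : A → CNF V) xs → ∣ concatMap g xs ∣ ≡ total (λ x → ∣ g x ∣) xs
∣concatMap∣ g xs = trans (∣concat∣ (map g xs)) (cong sum (sym (map-∘ xs)))

∣cartesianProductWith∣ : ∀ {A B V : Set} (g : A → B → Clause V) xs ys →
  ∣ cartesianProductWith g xs ys ∣ ≡ total (λ x → ∣ map (g x) ys ∣) xs
∣cartesianProductWith∣ g []       ys = refl
∣cartesianProductWith∣ g (x ∷ xs) ys = trans (∣++∣ (map (g x) ys) (cartesianProductWith g xs ys))
  (cong (∣ map (g x) ys ∣ +_) (∣cartesianProductWith∣ g xs ys))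

total-mono : ∀ {A : Set} {f g : A → ℕ} → (∀ x → f x ≤ g x) → ∀ xs → total f xs ≤ total g xs
total-mono f≤g []       = z≤n
total-mono f≤g (x ∷ xs) = +-mono-≤ (f≤g x) (total-mono f≤g xs)

total-tabulate : ∀ {A B : Set} {n} {f : A → ℕ} {g : B → ℕ} {h : Fin n → A} {k : Fin n → B} →
  (∀ i → f (h i) ≤ g (k i)) → total f (List.tabulate h) ≤ total g (List.tabulate k)
total-tabulate {n = zero}  le = z≤n
total-tabulate {n = suc n} le = +-mono-≤ (le zero) (total-tabulate (le ∘ suc))

-- The added agent is `zero`, and each old agent is shifted by `suc`.
total-allFin : ∀ {n} {f : Fin n → ℕ} {g : Fin (suc n) → ℕ} → (∀ i → f i ≤ g (suc i)) →
  total f (allFin n) ≤ total g (allFin (suc n))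
total-allFin {g = g} le = ≤-trans (total-tabulate le) (m≤n+m _ (g zero))

-- Prefixing the head of the list embeds the shorter vectors as the first block of the longer ones;
-- membership guarantees that there is a head.
total-allVecs : ∀ {A : Set} {n} {f : Vec A n → ℕ} {g : Vec A (suc n) → ℕ} {x xs} → x ∈ xs →
  (∀ x v → f v ≤ g (x ∷ v)) → total f (allVecs xs n) ≤ total g (allVecs xs (suc n))
total-allVecs {n = n} {f} {g} {xs = y ∷ ys} _ le = begin
  total f vs                               ≤⟨ total-mono (le y) vs ⟩
  total (λ v → g (y ∷ v)) vs               ≡⟨ cong sum (map-∘ vs) ⟩
  total g (map (y ∷_) vs)                  ≤⟨ m≤m+n _ _ ⟩
  total g (map (y ∷_) vs) + total g rest   ≡⟨ sum-++ (map g (map (y ∷_) vs)) (map g rest) ⟨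
  sum (map g (map (y ∷_) vs) ++ map g rest) ≡⟨ cong sum (map-++ g (map (y ∷_) vs) rest) ⟨
  total g (map (y ∷_) vs ++ rest)          ∎
  where
  open ≤-Reasoning
  vs   = allVecs (y ∷ ys) n
  rest = cartesianProductWith _∷_ ys vs

module _ (m n : ℕ) where

  private
    total-profiles : ∀ {f : Profile (suc m) n → ℕ} {g : Profile (suc m) (suc n) → ℕ} →
      (∀ π R → f R ≤ g (π ∷ R)) → total f (profiles (suc m) n) ≤ total g (profiles (suc m) (suc n))
    total-profiles = total-allVecs (∈-rankings identity)

    length-map≤ : ∀ {A B C : Set} {f : A → B} {g : A → C} (xs : List A) →
      length (map f xs) ≤ length (map g xs)
    length-map≤ {f = f} {g} xs = ≤-reflexive (trans (length-map f xs) (sym (length-map g xs)))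

    length≡total : ∀ {A B : Set} (f : A → B) xs → length (map f xs) ≡ total (const 1) xs
    length≡total f []       = refl
    length≡total f (x ∷ xs) = cong suc (length≡total f xs)

    perProfile : ∀ {A B : Set} {f : Profile (suc m) n → A} {g : Profile (suc m) (suc n) → B} →
      length (map f (profiles (suc m) n)) ≤ length (map g (profiles (suc m) (suc n)))
    perProfile {f = f} {g} = subst₂ _≤_ (sym (length≡total f (profiles (suc m) n)))
      (sym (length≡total g (profiles (suc m) (suc n)))) (total-profiles λ _ _ → ≤-refl)

    by-∣map∣ : ∀ {A B V W : Set} {f : A → Clause V} {g : B → Clause W} xs ys →
      total (length ∘ f) xs ≤ total (length ∘ g) ys → ∣ map f xs ∣ ≤ ∣ map g ys ∣
    by-∣map∣ {f = f} {g} xs ys = subst₂ _≤_ (sym (∣map∣ f xs)) (sym (∣map∣ g ys))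

    by-∣concatMap∣ : ∀ {A B V W : Set} (f : A → CNF V) (g : B → CNF W) xs ys →
      total (λ x → ∣ f x ∣) xs ≤ total (λ y → ∣ g y ∣) ys → ∣ concatMap f xs ∣ ≤ ∣ concatMap g ys ∣
    by-∣concatMap∣ f g xs ys = subst₂ _≤_ (sym (∣concatMap∣ f xs)) (sym (∣concatMap∣ g ys))

    by-∣++∣ : ∀ {V W : Set} (Ψ : CNF V) (Ξ : CNF W) {Ψ′ Ξ′} →
      ∣ Ψ ∣ ≤ ∣ Ξ ∣ → ∣ Ψ′ ∣ ≤ ∣ Ξ′ ∣ → ∣ Ψ ++ Ψ′ ∣ ≤ ∣ Ξ ++ Ξ′ ∣
    by-∣++∣ Ψ Ξ {Ψ′} {Ξ′} le le′ = subst₂ _≤_ (sym (∣++∣ Ψ Ψ′)) (sym (∣++∣ Ξ Ξ′)) (+-mono-≤ le le′)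

    someObject-mono : ∣ someObject (suc m) n ∣ ≤ ∣ someObject (suc m) (suc n) ∣
    someObject-mono = by-∣map∣ (profiles (suc m) n) (profiles (suc m) (suc n))
      (total-profiles λ _ _ → length-map≤ (allFin (suc m)))

    atMostOneObject-mono : ∣ atMostOneObject (suc m) n ∣ ≤ ∣ atMostOneObject (suc m) (suc n) ∣
    atMostOneObject-mono = subst₂ _≤_
      (sym (∣cartesianProductWith∣ _ (profiles (suc m) n) (distinctPairs (suc m) n)))
      (sym (∣cartesianProductWith∣ _ (profiles (suc m) (suc n)) (distinctPairs (suc m) n)))
      (total-profiles λ _ _ → by-∣map∣ (distinctPairs (suc m) n) (distinctPairs (suc m) n) ≤-refl)

    nonDictatorship-mono : ∣ nonDictatorship (suc m) n ∣ ≤ ∣ nonDictatorship (suc m) (suc n) ∣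
    nonDictatorship-mono = by-∣map∣ (allFin n) (allFin (suc n)) (total-allFin {n} λ _ → perProfile)

    onto-mono : ∣ onto (suc m) n ∣ ≤ ∣ onto (suc m) (suc n) ∣
    onto-mono = by-∣map∣ (allFin (suc m)) (allFin (suc m))
      (total-mono (λ _ → perProfile) (allFin (suc m)))

    module _ {n : ℕ} (R : Profile (suc m) n) where

      -- The nested bodies of `strategyproofness` receive names, so that they can be compared level
      -- by level.
      deviations : Fin (suc m) → Fin n → CNF (Var (suc m) n)
      deviations o i =
        map (λ π → neg (R , o) ∷ map (λ o′ → pos (s i R π , o′)) (pr i o R)) (rankings (suc m))

      deviationsAt : Fin (suc m) → CNF (Var (suc m) n)
      deviationsAt o = concatMap (deviations o) (allFin n)

      deviationsFrom : CNF (Var (suc m) n)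
      deviationsFrom = concatMap deviationsAt (allFin (suc m))

    -- Agent `suc i` of `π ∷ R` has the ranking of agent `i` of `R`, so both `pr` lists coincide and
    -- corresponding clauses are equally long.
    deviations-mono : ∀ π R o i → ∣ deviations {n} R o i ∣ ≤ ∣ deviations {suc n} (π ∷ R) o (suc i) ∣
    deviations-mono π R o i = by-∣map∣ (rankings (suc m)) (rankings (suc m))
      (total-mono (λ _ → s≤s (length-map≤ (pr i o R))) (rankings (suc m)))

    strategyproofness-mono : ∣ strategyproofness (suc m) n ∣ ≤ ∣ strategyproofness (suc m) (suc n) ∣
    strategyproofness-mono =
      by-∣concatMap∣ deviationsFrom deviationsFrom (profiles (suc m) n) (profiles (suc m) (suc n))
        (total-profiles λ π R →
          by-∣concatMap∣ (deviationsAt R) (deviationsAt (π ∷ R)) (allFin (suc m)) (allFin (suc m))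
            (total-mono (λ o →
              by-∣concatMap∣ (deviations R o) (deviations (π ∷ R) o) (allFin n) (allFin (suc n))
                (total-allFin {n} (deviations-mono π R o)))
              (allFin (suc m))))

  ∣GS∣-mono : ∣ GS (suc m) n ∣ ≤ ∣ GS (suc m) (suc n) ∣
  ∣GS∣-mono =
    by-∣++∣ (someObject (suc m) n) (someObject (suc m) (suc n)) someObject-mono
    (by-∣++∣ (atMostOneObject (suc m) n) (atMostOneObject (suc m) (suc n)) atMostOneObject-mono
    (by-∣++∣ (nonDictatorship (suc m) n) (nonDictatorship (suc m) (suc n)) nonDictatorship-mono
    (by-∣++∣ (onto (suc m) n) (onto (suc m) (suc n)) onto-mono strategyproofness-mono)))

-- Kernelization

refutationOf : ∀ x → Σ (Tree (clauseForms (Φ x)) ⊥) λ t → treeSize t ≤ ⟦ proj₁ refutation ⟧ ∣ Φ x ∣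
refutationOf (inst 0 n () _)
refutationOf (inst 1 n m≥3 _) = contradiction-irr m≥3 λ { (s≤s ()) }
refutationOf (inst 2 n m≥3 _) = contradiction-irr m≥3 λ { (s≤s (s≤s ())) }
refutationOf (inst (suc (suc (suc m))) n _ _) = proj₂ refutation m n

unsatisfiable : ∀ x → Satisfiable (Φ x) → Empty.⊥
unsatisfiable x = refutable⇒unsatisfiable (proj₁ (refutationOf x))

1≤∣Φ∣ : ∀ x → 1 ≤ ∣ Φ x ∣
1≤∣Φ∣ (inst 0 n () _)
1≤∣Φ∣ (inst (suc m) n _ _) = 1≤∣GS∣ {m} {n}

clauses≤∣Φ∣ : ∀ x → length (Φ x) ≤ ∣ Φ x ∣
clauses≤∣Φ∣ (inst 0 n () _)
clauses≤∣Φ∣ (inst (suc m) n _ _) = clauses≤∣GS∣ {m} {n}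

-- Polynomial and quasipolynomial bounds

refutationSize : Polynomial
refutationSize = toPolynomial (proj₁ refutation)

shortRefutation : ∀ x → HasRefutationOfSize≤ (Φ x) (eval refutationSize ∣ Φ x ∣)
shortRefutation x = let t , t≤ = refutationOf x in
  fregeProof t , ≤-trans (≤-reflexive (length-flatten t))
    (≤-trans t≤ (⟦⟧≤eval (proj₁ refutation) (1≤∣Φ∣ x)))

-- The induction follows the recursion of the logarithm, which passes from `2 + n` to its half,
-- rounded up.
n≤2^⌈log₂n⌉ : ∀ n → n ≤ 2 ^ ⌈log₂ n ⌉
n≤2^⌈log₂n⌉ n = bound n (<-wellFounded n)
  where
  bound : ∀ n (a : Acc _<_ n) → n ≤ 2 ^ ⌈log2⌉ n a
  bound 0 _ = z≤n
  bound 1 _ = ≤-refl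
  bound (suc (suc n)) (acc rs) = begin
    2 + n                                ≡⟨ cong (2 +_) (⌊n/2⌋+⌈n/2⌉≡n n) ⟨
    2 + (⌊ n /2⌋ + ⌈ n /2⌉)              ≤⟨ +-monoʳ-≤ 2 (+-monoˡ-≤ ⌈ n /2⌉ (⌊n/2⌋≤⌈n/2⌉ n)) ⟩
    2 + (⌈ n /2⌉ + ⌈ n /2⌉)              ≡⟨ cong suc (+-suc ⌈ n /2⌉ ⌈ n /2⌉) ⟨
    suc ⌈ n /2⌉ + suc ⌈ n /2⌉            ≡⟨ cong (suc ⌈ n /2⌉ +_) (+-identityʳ (suc ⌈ n /2⌉)) ⟨
    2 * suc ⌈ n /2⌉                      ≤⟨ *-monoʳ-≤ 2 (bound (suc ⌈ n /2⌉) (rs (⌈n/2⌉<n n))) ⟩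
    2 * 2 ^ ⌈log2⌉ (suc ⌈ n /2⌉) _       ∎
    where open ≤-Reasoning

-- The power `x ^ k` is at most 2 to `k` times the logarithm of `x`, so the logarithm needs only
-- exponent 1.
monomial-quasipolynomial : ∀ c k → Quasipolynomial (eval (monomial c k))
monomial-quasipolynomial c k = 1 , s≤s z≤n , c , k , 0 , λ x _ → begin
  eval (monomial c k) x          ≡⟨ eval-monomial c k x ⟩
  c * x ^ k                      ≤⟨ *-monoʳ-≤ c (^-monoˡ-≤ k (n≤2^⌈log₂n⌉ x)) ⟩
  c * (2 ^ ⌈log₂ x ⌉) ^ k        ≡⟨ cong (c *_) (^-*-assoc 2 ⌈log₂ x ⌉ k) ⟩
  c * 2 ^ (⌈log₂ x ⌉ * k)        ≡⟨ cong (λ e → c * 2 ^ e) (*-comm ⌈log₂ x ⌉ k) ⟩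
  c * 2 ^ (k * ⌈log₂ x ⌉)        ≡⟨ cong (λ e → c * 2 ^ (k * e)) (*-identityʳ ⌈log₂ x ⌉) ⟨
  c * 2 ^ (k * ⌈log₂ x ⌉ ^ 1)    ∎
  where open ≤-Reasoning

-- Removal of one agent

removeAgent : Instance → Maybe Instance
removeAgent (inst m (suc (suc (suc n))) m≥3 _) = just (inst m (suc (suc n)) m≥3 (s≤s (s≤s z≤n)))
removeAgent (inst m _ _ _)                     = nothing

removeAgent-agents : ∀ x {y} → removeAgent x ≡ just y → agents x ≡ suc (agents y)
removeAgent-agents (inst m (suc (suc (suc n))) _ _) refl = refl

removeAgent-objects : ∀ x {y} → removeAgent x ≡ just y → objects y ≡ objects x
removeAgent-objects (inst m (suc (suc (suc n))) _ _) refl = refl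

removeAgent-notLarger : ∀ x {y} → removeAgent x ≡ just y → ∣ Φ y ∣ ≤ ∣ Φ x ∣
removeAgent-notLarger (inst 0 _ () _)
removeAgent-notLarger (inst (suc m) (suc (suc (suc n))) _ _) refl = ∣GS∣-mono m (suc (suc n))

-- All instances are unsatisfiable, so any two are equivalent; in stepSoundness the
-- refutation likewise allows ⊥ to be substituted for every variable.
agentRemoval : Rule
agentRemoval = record
  { reduce     = removeAgent
  ; equivalent = λ {x} {y} _ → mk⇔ (Empty.⊥-elim ∘ unsatisfiable x) (Empty.⊥-elim ∘ unsatisfiable y)
  ; notLarger  = λ {x} → removeAgent-notLarger x
  }

rules : List Rule
rules = agentRemoval ∷ []

chain-objects : ∀ {x y} → Chain rules x y → objects y ≡ objects x
chain-objects ε                  = refl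
chain-objects {x} (here eq ◅ ch) = trans (chain-objects ch) (removeAgent-objects x eq)

chain-notLarger : ∀ {x y} → Chain rules x y → ∣ Φ y ∣ ≤ ∣ Φ x ∣
chain-notLarger ε                  = ≤-refl
chain-notLarger {x} (here eq ◅ ch) = ≤-trans (chain-notLarger ch) (removeAgent-notLarger x eq)

chainLength≤agents : ∀ {x y} (ch : Chain rules x y) → chainLength rules ch ≤ agents x
chainLength≤agents ε = z≤n
chainLength≤agents {x} (here eq ◅ ch) =
  ≤-trans (s≤s (chainLength≤agents ch)) (≤-reflexive (sym (removeAgent-agents x eq)))

-- Chains keep the number of objects, and only two agents are irreducible; hence the bound depends
-- on `m` alone.
kernelization : ∀ m → 3 ≤ m → Kernelization (λ x → objects x ≡ m)
kernelization m m≥3 = record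
  { rules  = rules
  ; bound  = ∣ Φ (inst m 2 m≥3 (s≤s (s≤s z≤n))) ∣
  ; kernel = λ where refl ch (irreducible ∷ []) → irreducible≤ _ (chain-objects ch) irreducible
  }
  where
  irreducible≤ : ∀ y → objects y ≡ m → removeAgent y ≡ nothing →
    ∣ Φ y ∣ ≤ ∣ Φ (inst m 2 m≥3 (s≤s (s≤s z≤n))) ∣
  irreducible≤ (inst m 0 _ ()) refl _
  irreducible≤ (inst m 1 _ n≥2) refl _ = contradiction-irr n≥2 λ { (s≤s ()) }
  irreducible≤ (inst m 2 _ _) refl _ = ≤-refl

-- The tautology takes 7 lines. Each of at most `N` target clauses takes a refutation, 7 lines of ex
-- falso and one modus ponens.
stepCost : Cost
stepCost = con 7 ⊕ N ⊗ (con 8 ⊕ proj₁ refutation)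

stepSoundness : ∀ x y z → ∣ Φ y ∣ ≤ ∣ Φ x ∣ → ∣ Φ z ∣ ≤ ∣ Φ x ∣ →
  StepSoundness y z 1 (eval (toPolynomial stepCost) ∣ Φ x ∣)
stepSoundness x y z y≤x z≤x = record
  { r            = 1
  ; r≤R          = ≤-refl
  ; Ξ            = λ _ → ⊥ ⇒ ⊥
  ; tautology    = fregeProof tautologyTree
  ; η            = λ _ → record
    { Name = VarOf z ; formula = rename id (Φ z) ; bijection = ↔-id _ ; renamed = refl }
  ; implications = λ _ → record { substitution = const ⊥ ; proof = proj₁ consequences }
  ; totalSize    = ≤-trans (+-mono-≤
      (≤-trans (≤-reflexive (length-flatten tautologyTree)) tautologySize)
      (≤-trans (≤-reflexive (+-identityʳ _)) (≤-trans (proj₂ consequences) consequencesSize)))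
      (⟦⟧≤eval stepCost (1≤∣Φ∣ x))
  }
  where
  identityProof : Frege.Bounded {VarOf y} [] ⊥ ⊥ 5
  identityProof = Frege.proof (Frege.assumption [])
  tautologyTree : Tree {VarOf y} [] ((⊥ ⇒ ⊥) ∨ ⊥)
  -- The disjunction of a one-element list still ends in `⊥`.
  tautologyTree = mp (axiom (inl _ _)) (proj₁ identityProof)
  tautologySize : treeSize tautologyTree ≤ 7
  tautologySize = s≤s (s≤s (proj₂ identityProof))
  everything : ∀ A → Σ (Tree ((⊥ ⇒ ⊥) ∷ clauseForms (Φ y)) A) λ t →
    treeSize t ≤ 8 + ⟦ proj₁ refutation ⟧ ∣ Φ x ∣
  everything A = let t , t≤ = Frege.proof (Frege.exFalso {V = VarOf y} [] {A = A})
                     u , u≤ = refutationOf y in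
    -- Ex falso is derived over the empty CNF, so its tree uses no hypotheses and fits any context.
    mp (Tree-⊆ (λ ()) t) (Tree-⊆ there u) ,
    s≤s (+-mono-≤ (≤-trans (≤-reflexive (treeSize-⊆ {Δ = (⊥ ⇒ ⊥) ∷ clauseForms (Φ y)} (λ ()) t)) t≤)
      (≤-trans (≤-reflexive (treeSize-⊆ there u))
        (≤-trans u≤ (⟦⟧-mono (proj₁ refutation) y≤x))))
  Δ = map (_[ const ⊥ ]) (clauseForms (rename id (Φ z)))
  consequences = fregeProofs everything Δ
  consequencesSize : length Δ * (8 + ⟦ proj₁ refutation ⟧ ∣ Φ x ∣) ≤
    ∣ Φ x ∣ * (8 + ⟦ proj₁ refutation ⟧ ∣ Φ x ∣)
  consequencesSize = *-monoˡ-≤ (8 + ⟦ proj₁ refutation ⟧ ∣ Φ x ∣) (begin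
    length Δ                             ≡⟨ length-map (_[ const ⊥ ]) (clauseForms (rename id (Φ z))) ⟩
    length (clauseForms (rename id (Φ z))) ≡⟨ length-map clauseForm (rename id (Φ z)) ⟩
    length (rename id (Φ z))             ≡⟨ length-map (map (renameLiteral id)) (Φ z) ⟩
    length (Φ z)                         ≤⟨ clauses≤∣Φ∣ z ⟩
    ∣ Φ z ∣                              ≤⟨ z≤x ⟩
    ∣ Φ x ∣                              ∎)
    where open ≤-Reasoning

-- Steps are measured against the initial instance, which is at least as large as every later one.
polynomialSoundness : ∀ m m≥3 → PolynomialSoundness (kernelization m m≥3)
polynomialSoundness m m≥3 = 1 , ≤-refl , toPolynomial stepCost , λ
  { {x} {y} {z} _ ch (here eq) → stepSoundness x y z (chain-notLarger {x} {y} ch)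
      (≤-trans (removeAgent-notLarger y eq) (chain-notLarger {x} {y} ch)) }

theorem7 : ((m : ℕ) → 3 ≤ m →
    Σ (Kernelization (λ x → objects x ≡ m)) λ K →
    LinearLength K × PolynomialSoundness K)
    × (∃ λ (f : ℕ → ℕ) → Quasipolynomial f ×
    ((x : Instance) → HasRefutationOfSize≤ (Φ x) (f ∣ Φ x ∣)))
    × ((n : ℕ) → 2 ≤ n →
    ∃ λ (p : Polynomial) →
    (x : Instance) → agents x ≡ n → HasRefutationOfSize≤ (Φ x) (eval p ∣ Φ x ∣))
theorem7 =
  (λ m m≥3 → kernelization m m≥3 ,
    (1 , λ {x} _ ch → ≤-trans (chainLength≤agents ch) (≤-reflexive (sym (*-identityˡ (agents x))))) ,
    polynomialSoundness m m≥3) ,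
  (eval refutationSize ,
    monomial-quasipolynomial (coefficient (proj₁ refutation)) (exponent (proj₁ refutation)) ,
    shortRefutation) ,
  λ n _ → refutationSize , λ x _ → shortRefutation x
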